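{- Let $G$ be a connected graph with $n$ vertices, independence number $\alpha(G)$ and diameter $d(G)\leq 2$. Then $$m_{D^{L}(G)}(2n-1,2n)=\alpha(G)-1=\frac{n}{2}-1$$ if and only if $G$ is (isomorphic to) the corona $H\circ K_1$ for some connected graph $H$.
   Context: All graphs are finite, simple and connected. The corona $H\circ K_1$ of a graph $H$ is obtained from $H$ by attaching to each vertex $v$ of $H$ one new vertex adjacent only to $v$. For a connected graph $G$ with vertex set $\{v_1,\dots,v_n\}$, $d_{uv}$ is the length of a shortest path between $u$ and $v$, the diameter is the maximum of the $d_{uv}$, $D(G)=(d_{uv})$ is the distance matrix, $Tr(v)=\sum_{u\in V(G)}d_{uv}$ is the transmission of $v$, and the distance Laplacian matrix is $D^L(G)=\mathrm{diag}(Tr(v_1),\dots,Tr(v_n))-D(G)$. Its eigenvalues (all real) are the distance Laplacian eigenvalues of $G$. For an interval $I\subseteq\mathbb{R}$, $m_{D^L(G)}I$ denotes the number of distance Laplacian eigenvalues of $G$, counted with multiplicity, lying in $I$. -}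

module Defs where

open import Data.Bool.Base using (if_then_else_)
open import Data.Empty using (⊥)
open import Data.Fin.Base using (Fin)
import Data.Fin.Properties as Fin
open import Data.Fin.Subset using (Subset; ∣_∣; _∈_) renaming (⊥ to ∅)
open import Data.Fin.Subset.Properties using (∉⊥; ∣⊥∣≡0; ∣p∣≤n; _∈?_; anySubset?)
open import Data.Integer.Base as ℤ using (ℤ; +_)
open import Data.List.Base using (List; []; _∷_)
open import Data.List.Relation.Unary.Unique.Propositional using (Unique)
import Data.List.Relation.Unary.Unique.DecPropositional as DecUnique
open import Data.Nat.Base as ℕ using (ℕ; zero; suc)
import Data.Nat.Properties as ℕ
open import Data.Product.Base using (∃; Σ-syntax; ∃-syntax; _×_; _,_; proj₁; proj₂)
open import Data.Rational.Base as ℚ using (ℚ; 0ℚ; 1ℚ)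
import Data.Rational.Properties as ℚ
open import Data.Rational.Solver using (module +-*-Solver)
open import Data.Sum.Base using (_⊎_; inj₁; inj₂)
open import Data.Vec.Functional as Vector using (Vector)
open import Function.Base using (_∘_)
open import Function.Bundles using (_⇔_; _↔_; Inverse)
open import Relation.Binary.PropositionalEquality
  using (_≡_; refl; sym; trans; cong; subst)
open import Relation.Nullary using (¬_; Dec; yes; no; does; contradiction)
open import Relation.Nullary.Decidable using (map′; ¬?; _×-dec_; _→-dec_)
open import Relation.Unary using (Pred; Decidable)
open import Level using (0ℓ)

------------------------------------------------------------------------
-- Real numbers, as rational Cauchy sequences with a modulus

Cauchy : (ℕ → ℚ) → Set
Cauchy x = ∀ ε → 0ℚ ℚ.< ε →
  ∃[ N ] (∀ m n → N ℕ.≤ m → N ℕ.≤ n → ℚ.∣ x m ℚ.- x n ∣ ℚ.< ε)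

record ℝ : Set where
  constructor mkℝ
  field
    seq    : ℕ → ℚ
    cauchy : Cauchy seq

open ℝ public

infix  4 _≈_ _<ℝ_
infixl 6 _+ℝ_
infixl 7 _*ℝ_

_≈_ : ℝ → ℝ → Set
x ≈ y = ∀ ε → 0ℚ ℚ.< ε →
  ∃[ N ] (∀ n → N ℕ.≤ n → ℚ.∣ seq x n ℚ.- seq y n ∣ ℚ.< ε)

_<ℝ_ : ℝ → ℝ → Set
x <ℝ y = ∃[ ε ] (0ℚ ℚ.< ε ×
  ∃[ N ] (∀ n → N ℕ.≤ n → seq x n ℚ.+ ε ℚ.< seq y n))

fromℚ : ℚ → ℝ
fromℚ q = mkℝ (λ _ → q) λ ε ε>0 →
  0 , λ _ _ _ _ → subst (ℚ._< ε) (sym (cong ℚ.∣_∣ (ℚ.+-inverseʳ q))) ε>0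

fromℤ : ℤ → ℝ
fromℤ z = fromℚ (z ℚ./ 1)

0ℝ : ℝ
0ℝ = fromℚ 0ℚ

private
  module _ where
    open +-*-Solver

    a≡a-b+b : ∀ a b → a ≡ (a ℚ.- b) ℚ.+ b
    a≡a-b+b = solve 2 (λ a b → a := (a :- b) :+ b) refl

    sum-difference : ∀ a b c d →
      (a ℚ.+ b) ℚ.- (c ℚ.+ d) ≡ (a ℚ.- c) ℚ.+ (b ℚ.- d)
    sum-difference = solve 4 (λ a b c d →
      (a :+ b) :- (c :+ d) := (a :- c) :+ (b :- d)) refl

    product-difference : ∀ a b c d →
      a ℚ.* b ℚ.- c ℚ.* d ≡ a ℚ.* (b ℚ.- d) ℚ.+ d ℚ.* (a ℚ.- c)
    product-difference = solve 4 (λ a b c d →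
      a :* b :- c :* d := a :* (b :- d) :+ d :* (a :- c)) refl

  half : ∀ ε → 0ℚ ℚ.< ε → ∃[ δ ] (0ℚ ℚ.< δ × δ ℚ.+ δ ≡ ε)
  half ε ε>0 =
    ε ℚ.* ℚ.½ ,
    subst (ℚ._< ε ℚ.* ℚ.½) (ℚ.*-zeroˡ ℚ.½) (ℚ.*-monoˡ-<-pos ℚ.½ ε>0) ,
    trans (sym (ℚ.*-distribˡ-+ ε ℚ.½ ℚ.½)) (ℚ.*-identityʳ ε)

  divide : ∀ ε B → 0ℚ ℚ.< ε → 0ℚ ℚ.< B → ∃[ δ ] (0ℚ ℚ.< δ × B ℚ.* δ ≡ ε)
  divide ε B ε>0 B>0 = ε ℚ.* B⁻¹ , δ>0 , Bδ≡ε
    where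
    instance
      B-pos : ℚ.Positive B
      B-pos = ℚ.positive B>0
      B-nz : ℚ.NonZero B
      B-nz = ℚ.pos⇒nonZero B
    B⁻¹ : ℚ
    B⁻¹ = ℚ.1/ B
    instance
      B⁻¹-pos : ℚ.Positive B⁻¹
      B⁻¹-pos = ℚ.1/pos⇒pos B
    δ>0 : 0ℚ ℚ.< ε ℚ.* B⁻¹
    δ>0 = subst (ℚ._< ε ℚ.* B⁻¹) (ℚ.*-zeroˡ B⁻¹) (ℚ.*-monoˡ-<-pos B⁻¹ ε>0)
    Bδ≡ε : B ℚ.* (ε ℚ.* B⁻¹) ≡ ε
    Bδ≡ε = trans (cong (B ℚ.*_) (ℚ.*-comm ε B⁻¹))
          (trans (sym (ℚ.*-assoc B B⁻¹ ε))
          (trans (cong (ℚ._* ε) (ℚ.*-inverseʳ B)) (ℚ.*-identityˡ ε)))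

  bounded : ∀ x → Cauchy x →
    ∃[ B ] (0ℚ ℚ.< B × ∃[ N ] (∀ n → N ℕ.≤ n → ℚ.∣ x n ∣ ℚ.≤ B))
  bounded x c with c 1ℚ (ℚ.positive⁻¹ 1ℚ)
  ... | N , close = 1ℚ ℚ.+ ℚ.∣ x N ∣ , B>0 , N , bound
    where
    open ℚ.≤-Reasoning
    B>0 : 0ℚ ℚ.< 1ℚ ℚ.+ ℚ.∣ x N ∣
    B>0 = ℚ.+-mono-<-≤ (ℚ.positive⁻¹ 1ℚ) (ℚ.0≤∣p∣ (x N))
    bound : ∀ n → N ℕ.≤ n → ℚ.∣ x n ∣ ℚ.≤ 1ℚ ℚ.+ ℚ.∣ x N ∣
    bound n N≤n = begin
      ℚ.∣ x n ∣
        ≡⟨ cong ℚ.∣_∣ (a≡a-b+b (x n) (x N)) ⟩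
      ℚ.∣ (x n ℚ.- x N) ℚ.+ x N ∣
        ≤⟨ ℚ.∣p+q∣≤∣p∣+∣q∣ (x n ℚ.- x N) (x N) ⟩
      ℚ.∣ x n ℚ.- x N ∣ ℚ.+ ℚ.∣ x N ∣
        ≤⟨ ℚ.+-monoˡ-≤ ℚ.∣ x N ∣ (ℚ.<⇒≤ (close n N N≤n ℕ.≤-refl)) ⟩
      1ℚ ℚ.+ ℚ.∣ x N ∣ ∎

_+ℝ_ : ℝ → ℝ → ℝ
seq    (x +ℝ y) n = seq x n ℚ.+ seq y n
cauchy (x +ℝ y) ε ε>0 with half ε ε>0
... | δ , δ>0 , refl with cauchy x δ δ>0 | cauchy y δ δ>0
...   | N₁ , close₁ | N₂ , close₂ = N₁ ℕ.⊔ N₂ , close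
  where
  open ℚ.≤-Reasoning
  close : ∀ m n → N₁ ℕ.⊔ N₂ ℕ.≤ m → N₁ ℕ.⊔ N₂ ℕ.≤ n →
    ℚ.∣ (seq x m ℚ.+ seq y m) ℚ.- (seq x n ℚ.+ seq y n) ∣ ℚ.< δ ℚ.+ δ
  close m n N≤m N≤n = begin-strict
    ℚ.∣ (seq x m ℚ.+ seq y m) ℚ.- (seq x n ℚ.+ seq y n) ∣
      ≡⟨ cong ℚ.∣_∣ (sum-difference (seq x m) (seq y m) (seq x n) (seq y n)) ⟩
    ℚ.∣ (seq x m ℚ.- seq x n) ℚ.+ (seq y m ℚ.- seq y n) ∣
      ≤⟨ ℚ.∣p+q∣≤∣p∣+∣q∣ (seq x m ℚ.- seq x n) (seq y m ℚ.- seq y n) ⟩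
    ℚ.∣ seq x m ℚ.- seq x n ∣ ℚ.+ ℚ.∣ seq y m ℚ.- seq y n ∣
      <⟨ ℚ.+-mono-< (close₁ m n (ℕ.m⊔n≤o⇒m≤o N₁ N₂ N≤m) (ℕ.m⊔n≤o⇒m≤o N₁ N₂ N≤n))
                    (close₂ m n (ℕ.m⊔n≤o⇒n≤o N₁ N₂ N≤m) (ℕ.m⊔n≤o⇒n≤o N₁ N₂ N≤n)) ⟩
    δ ℚ.+ δ ∎

private
  product-bound : ∀ p q C γ δ → 0ℚ ℚ.< C → C ℚ.* γ ≡ δ →
    ℚ.∣ p ∣ ℚ.≤ C → ℚ.∣ q ∣ ℚ.< γ → ℚ.∣ p ℚ.* q ∣ ℚ.< δ
  product-bound p q C γ δ C>0 Cγ≡δ p≤C q<γ = begin-strict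
    ℚ.∣ p ℚ.* q ∣       ≡⟨ ℚ.∣p*q∣≡∣p∣*∣q∣ p q ⟩
    ℚ.∣ p ∣ ℚ.* ℚ.∣ q ∣ ≤⟨ ℚ.*-monoʳ-≤-nonNeg ℚ.∣ q ∣ {{ℚ.∣-∣-nonNeg q}} p≤C ⟩
    C ℚ.* ℚ.∣ q ∣       <⟨ ℚ.*-monoʳ-<-pos C {{ℚ.positive C>0}} q<γ ⟩
    C ℚ.* γ             ≡⟨ Cγ≡δ ⟩
    δ                   ∎
    where open ℚ.≤-Reasoning

  product-close : ∀ a b c d δ → ℚ.∣ a ℚ.* (b ℚ.- d) ∣ ℚ.< δ →
    ℚ.∣ d ℚ.* (a ℚ.- c) ∣ ℚ.< δ → ℚ.∣ a ℚ.* b ℚ.- c ℚ.* d ∣ ℚ.< δ ℚ.+ δ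
  product-close a b c d δ p<δ q<δ =
    subst (λ t → ℚ.∣ t ∣ ℚ.< δ ℚ.+ δ) (sym (product-difference a b c d))
      (ℚ.≤-<-trans (ℚ.∣p+q∣≤∣p∣+∣q∣ (a ℚ.* (b ℚ.- d)) (d ℚ.* (a ℚ.- c)))
                   (ℚ.+-mono-< p<δ q<δ))

  below : ∀ a b c d {n} → (a ℕ.⊔ b) ℕ.⊔ (c ℕ.⊔ d) ℕ.≤ n →
    a ℕ.≤ n × b ℕ.≤ n × c ℕ.≤ n × d ℕ.≤ n
  below a b c d p =
    let q = ℕ.m⊔n≤o⇒m≤o (a ℕ.⊔ b) (c ℕ.⊔ d) p
        r = ℕ.m⊔n≤o⇒n≤o (a ℕ.⊔ b) (c ℕ.⊔ d) p
    in ℕ.m⊔n≤o⇒m≤o a b q , ℕ.m⊔n≤o⇒n≤o a b q ,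
       ℕ.m⊔n≤o⇒m≤o c d r , ℕ.m⊔n≤o⇒n≤o c d r

  *-cauchy : ∀ x y → Cauchy x → Cauchy y → Cauchy (λ n → x n ℚ.* y n)
  *-cauchy x y cx cy ε ε>0 =
    let δ , δ>0 , δ+δ≡ε      = half ε ε>0
        A , A>0 , M₁ , ∣x∣≤A = bounded x cx
        B , B>0 , M₂ , ∣y∣≤B = bounded y cy
        α , α>0 , Aα≡δ       = divide δ A δ>0 A>0
        β , β>0 , Bβ≡δ       = divide δ B δ>0 B>0
        N₁ , close₁          = cx β β>0
        N₂ , close₂          = cy α α>0
    in (M₁ ℕ.⊔ M₂) ℕ.⊔ (N₁ ℕ.⊔ N₂) , λ m n m≥ n≥ →
      let M₁≤m , _    , N₁≤m , N₂≤m = below M₁ M₂ N₁ N₂ m≥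
          _    , M₂≤n , N₁≤n , N₂≤n = below M₁ M₂ N₁ N₂ n≥
      in subst (ℚ.∣ x m ℚ.* y m ℚ.- x n ℚ.* y n ∣ ℚ.<_) δ+δ≡ε
        (product-close (x m) (y m) (x n) (y n) δ
          (product-bound (x m) (y m ℚ.- y n) A α δ A>0 Aα≡δ
            (∣x∣≤A m M₁≤m) (close₂ m n N₂≤m N₂≤n))
          (product-bound (y n) (x m ℚ.- x n) B β δ B>0 Bβ≡δ
            (∣y∣≤B n M₂≤n) (close₁ m n N₁≤m N₁≤n)))

_*ℝ_ : ℝ → ℝ → ℝ
seq    (x *ℝ y) n = seq x n ℚ.* seq y n
cauchy (x *ℝ y) = *-cauchy (seq x) (seq y) (cauchy x) (cauchy y)

⟨_,_⟩ : ℝ → ℝ → Pred ℝ 0ℓ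
⟨ a , b ⟩ x = a <ℝ x × x <ℝ b

------------------------------------------------------------------------
-- Linear algebra over ℝ

Matrix : Set → ℕ → Set
Matrix A n = Fin n → Fin n → A

Σℝ : ∀ {n} → Vector ℝ n → ℝ
Σℝ = Vector.foldr _+ℝ_ 0ℝ

Σℕ : ∀ {n} → Vector ℕ n → ℕ
Σℕ = Vector.foldr ℕ._+_ 0

infix 4 _≋_

_≋_ : ∀ {n} → Vector ℝ n → Vector ℝ n → Set
v ≋ w = ∀ i → v i ≈ w i

𝟎 : ∀ {n} → Vector ℝ n
𝟎 _ = 0ℝ

module _ {n : ℕ} where

  infixr 7 _·_

  _·_ : ℝ → Vector ℝ n → Vector ℝ n
  (c · v) i = c *ℝ v i

  _⊛_ : Matrix ℝ n → Vector ℝ n → Vector ℝ n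
  (M ⊛ v) i = Σℝ λ j → M i j *ℝ v j

  combination : ∀ {k} → Vector ℝ k → Vector (Vector ℝ n) k → Vector ℝ n
  combination c b i = Σℝ λ j → c j *ℝ b j i

  LinearlyIndependent : ∀ {k} → Vector (Vector ℝ n) k → Set
  LinearlyIndependent b = ∀ c → combination c b ≋ 𝟎 → c ≋ 𝟎

  record IsBasis (W : Pred (Vector ℝ n) 0ℓ) {k} (b : Vector (Vector ℝ n) k) : Set where
    field
      members     : ∀ j → W (b j)
      independent : LinearlyIndependent b
      spanning    : ∀ v → W v → ∃[ c ] v ≋ combination c b

  HasDimension : Pred (Vector ℝ n) 0ℓ → ℕ → Set
  HasDimension W k = Σ[ b ∈ Vector (Vector ℝ n) k ] IsBasis W b

  Eigenspace : Matrix ℝ n → ℝ → Pred (Vector ℝ n) 0ℓ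
  Eigenspace M θ v = M ⊛ v ≋ θ · v

  IsEigenvalue : Matrix ℝ n → Pred ℝ 0ℓ
  IsEigenvalue M θ = ∃[ v ] (¬ (v ≋ 𝟎) × Eigenspace M θ v)

  -- "M has exactly m eigenvalues in I, counted with multiplicity".  The
  -- multiplicity of θ is the dimension of its eigenspace; for the symmetric
  -- matrices considered here this is also its multiplicity as a root of the
  -- characteristic polynomial.
  record EigenvalueCount (M : Matrix ℝ n) (I : Pred ℝ 0ℓ) (m : ℕ) : Set where
    field
      r            : ℕ
      eigenvalues  : Vector ℝ r
      distinct     : ∀ i j → eigenvalues i ≈ eigenvalues j → i ≡ j
      isEigenvalue : ∀ i → IsEigenvalue M (eigenvalues i)
      inInterval   : ∀ i → I (eigenvalues i)
      complete     : ∀ θ → IsEigenvalue M θ → I θ → ∃[ i ] θ ≈ eigenvalues i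
      multiplicity : Vector ℕ r
      dimension    : ∀ i → HasDimension (Eigenspace M (eigenvalues i)) (multiplicity i)
      total        : m ≡ Σℕ multiplicity

------------------------------------------------------------------------
-- Graphs

record Graph (V : Set) : Set₁ where
  infix 4 _~_ _~?_
  field
    _~_     : V → V → Set
    _~?_    : ∀ u v → Dec (u ~ v)
    ~-sym   : ∀ {u v} → u ~ v → v ~ u
    ~-irrefl : ∀ {v} → ¬ (v ~ v)

module _ {V : Set} (G : Graph V) where
  open Graph G

  data Walk : V → V → Set where
    stop : ∀ v → Walk v v
    step : ∀ u {v w} → u ~ v → Walk v w → Walk u w

module _ {V : Set} {G : Graph V} where

  vertices : ∀ {u v} → Walk G u v → List V
  vertices (stop v)     = v ∷ []
  vertices (step u _ p) = u ∷ vertices p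

  length : ∀ {u v} → Walk G u v → ℕ
  length (stop _)     = 0
  length (step _ _ p) = suc (length p)

  IsPath : ∀ {u v} → Walk G u v → Set
  IsPath p = Unique (vertices p)

PathOfLength : ∀ {V} (G : Graph V) → V → V → ℕ → Set
PathOfLength G u v ℓ = Σ[ p ∈ Walk G u v ] (IsPath p × length p ≡ ℓ)

record Connected {V : Set} (G : Graph V) : Set where
  field
    nonempty : V
    path     : ∀ u v → ∃[ ℓ ] PathOfLength G u v ℓ

record _≅_ {V W : Set} (G : Graph V) (H : Graph W) : Set where
  private
    module G = Graph G
    module H = Graph H
  field
    bijection : V ↔ W
    adjacency : ∀ u v → (u G.~ v) ⇔ (Inverse.to bijection u H.~ Inverse.to bijection v)

infix 4 _≅_

-- inj₂ v is the pendant vertex attached to inj₁ v.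
_∘K₁ : ∀ {k} → Graph (Fin k) → Graph (Fin k ⊎ Fin k)
_∘K₁ {k} H = record
  { _~_      = adj
  ; _~?_     = adj?
  ; ~-sym    = λ {u} {v} → adj-sym u v
  ; ~-irrefl = λ {v} → adj-irrefl v
  }
  where
  open Graph H
  adj : Fin k ⊎ Fin k → Fin k ⊎ Fin k → Set
  adj (inj₁ u) (inj₁ v) = u ~ v
  adj (inj₁ u) (inj₂ v) = u ≡ v
  adj (inj₂ u) (inj₁ v) = u ≡ v
  adj (inj₂ _) (inj₂ _) = ⊥

  adj? : ∀ u v → Dec (adj u v)
  adj? (inj₁ u) (inj₁ v) = u ~? v
  adj? (inj₁ u) (inj₂ v) = u Fin.≟ v
  adj? (inj₂ u) (inj₁ v) = u Fin.≟ v
  adj? (inj₂ _) (inj₂ _) = no λ ()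

  adj-sym : ∀ u v → adj u v → adj v u
  adj-sym (inj₁ _) (inj₁ _) = ~-sym
  adj-sym (inj₁ _) (inj₂ _) = sym
  adj-sym (inj₂ _) (inj₁ _) = sym

  adj-irrefl : ∀ v → ¬ adj v v
  adj-irrefl (inj₁ _) = ~-irrefl

private
  least : ∀ {P : Pred ℕ 0ℓ} → Decidable P → ∃ P →
    ∃[ m ] (P m × (∀ k → P k → m ℕ.≤ k))
  least {P} P? (w , Pw) = go w P P? Pw
    where
    go : ∀ w (P : Pred ℕ 0ℓ) → Decidable P → P w →
      ∃[ m ] (P m × (∀ k → P k → m ℕ.≤ k))
    go zero    P P? Pw = 0 , Pw , λ _ _ → ℕ.z≤n
    go (suc w) P P? Pw with P? 0
    ... | yes P0 = 0 , P0 , λ _ _ → ℕ.z≤n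
    ... | no ¬P0 with go w (P ∘ suc) (P? ∘ suc) Pw
    ...   | m , Pm , min = suc m , Pm , λ where
              zero    P0  → contradiction P0 ¬P0
              (suc k) Psk → ℕ.s≤s (min k Psk)

  greatest : ∀ {P : Pred ℕ 0ℓ} → Decidable P → P 0 → ∀ n → (∀ k → P k → k ℕ.≤ n) →
    ∃[ m ] (P m × (∀ k → P k → k ℕ.≤ m))
  greatest P? P0 zero    bound = 0 , P0 , bound
  greatest {P} P? P0 (suc n) bound with P? (suc n)
  ... | yes Psn = suc n , Psn , bound
  ... | no ¬Psn = greatest P? P0 n λ k Pk →
    ℕ.≤-pred (ℕ.≤∧≢⇒< (bound k Pk) λ k≡ → ¬Psn (subst P k≡ Pk))

module _ {n : ℕ} (G : Graph (Fin n)) where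
  open Graph G

  Independent : Pred (Subset n) 0ℓ
  Independent S = ∀ u v → u ∈ S → v ∈ S → ¬ (u ~ v)

  IndependentOfSize : Pred ℕ 0ℓ
  IndependentOfSize k = ∃[ S ] (Independent S × ∣ S ∣ ≡ k)

  independenceNumber-spec :
    ∃[ α ] (IndependentOfSize α × (∀ k → IndependentOfSize k → k ℕ.≤ α))
  independenceNumber-spec = greatest
    (λ k → anySubset? λ S →
      Fin.all? (λ u → Fin.all? λ v →
        (u ∈? S) →-dec ((v ∈? S) →-dec ¬? (u ~? v)))
      ×-dec (∣ S ∣ ℕ.≟ k))
    (∅ , (λ _ _ u∈∅ _ _ → ∉⊥ u∈∅) , ∣⊥∣≡0 n)
    n
    λ { _ (S , _ , refl) → ∣p∣≤n S }

  independenceNumber : ℕ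
  independenceNumber = proj₁ independenceNumber-spec

  private
    walk? : ∀ {P : Pred (List (Fin n)) 0ℓ} → Decidable P → ∀ ℓ u v →
      Dec (Σ[ p ∈ Walk G u v ] (P (vertices p) × length p ≡ ℓ))
    walk? P? zero u v with u Fin.≟ v
    ... | no  u≢v  = no λ { (stop _ , _) → u≢v refl ; (step _ _ _ , _ , ()) }
    ... | yes refl = map′ (λ Pu → stop u , Pu , refl)
                          (λ { (stop _ , Pu , _) → Pu ; (step _ _ _ , _ , ()) })
                          (P? (u ∷ []))
    walk? P? (suc ℓ) u v = map′
      (λ { (_ , u~w , p , Pp , len) → step u u~w p , Pp , cong suc len })
      (λ { (stop _ , _ , ()) ; (step _ u~w p , Pp , len) → _ , u~w , p , Pp , ℕ.suc-injective len })
      (Fin.any? λ w → (u ~? w) ×-dec walk? (P? ∘ (u ∷_)) ℓ w v)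

  module _ (connected : Connected G) where

    distance-spec : ∀ u v →
      ∃[ d ] (PathOfLength G u v d × (∀ ℓ → PathOfLength G u v ℓ → d ℕ.≤ ℓ))
    distance-spec u v = least
      (λ ℓ → walk? (DecUnique.unique? Fin._≟_) ℓ u v)
      (Connected.path connected u v)

    distance : Matrix ℕ n
    distance u v = proj₁ (distance-spec u v)

    diameter : ℕ
    diameter = Vector.foldr ℕ._⊔_ 0 λ u → Vector.foldr ℕ._⊔_ 0 λ v → distance u v

    transmission : Fin n → ℕ
    transmission v = Σℕ λ u → distance u v

    distanceLaplacian : Matrix ℝ n
    distanceLaplacian u v = fromℤ
      ((if does (u Fin.≟ v) then + transmission u else + 0) ℤ.- + distance u v)

-- A corona H ∘ K₁ of diameter at most 2 is K₂, so the claim is that the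
-- eigenvalue count forces n = 2.  For m = n/2 - 1 > 0, the eigenvectors x for
-- eigenvalues above β = 2n - 1 are orthogonal to the all-ones vector and span a
-- space of dimension m on which the energy Σ d(u,v) (x u - x v)² = 2 ⟨x , Dᴸ x⟩
-- exceeds 2 β ⟨x , x⟩.  If all degrees are at least n/2, no x orthogonal to the
-- all-ones vector has so large an energy.  Otherwise some v has degree at most m;
-- its neighbours dominate the graph because the diameter is at most 2, so they
-- are the centres of a partition into at most m stars, and the energy is at most
-- 2 β ⟨x , x⟩ as soon as x sums to zero on every star.  One of these conditions
-- follows from the others, so at most m - 1 linear equations cut out a nonzero x
-- in the m-dimensional span, a contradiction.

module Submission where

open import Algebra.Bundles using (CommutativeRing)
import Algebra.Properties.Semiring.Sum as SemiringSum
import Algebra.Solver.Ring as RingSolver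
open import Algebra.Solver.Ring.AlmostCommutativeRing
  using (fromCommutativeRing; _-Raw-AlmostCommutative⟶_; Induced-equivalence)
open import Data.Bool.Base using (if_then_else_)
open import Data.Empty using (⊥)
open import Data.Fin.Base using (Fin; zero; suc; punchIn; _↑ˡ_; _↑ʳ_; splitAt)
import Data.Fin.Permutation as Permutation
import Data.Fin.Properties as Fin
open import Data.Fin.Subset using (∣_∣; inside; outside; ⁅_⁆)
import Data.Fin.Subset.Properties as Subset
open import Data.Integer.Base as ℤ using (ℤ; +_; -[1+_]; 1ℤ)
import Data.Integer.Properties as ℤ
import Data.List.Base as List
open import Data.List.Membership.Propositional.Properties
  using (∈-filter⁺; ∈-filter⁻; ∈-allFin; ∈-lookup)
open import Data.List.Relation.Unary.All using ([]; _∷_)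
open import Data.List.Relation.Unary.AllPairs using ([]; _∷_)
open import Data.List.Relation.Unary.Any using (index)
import Data.List.Relation.Unary.Any.Properties as Any
open import Data.Maybe.Base using (just; nothing)
open import Data.Nat.Base as ℕ using (ℕ; zero; suc)
import Data.Nat.Properties as ℕ
import Data.Nat.Solver as ℕ-Solver
open import Data.Product.Base
  using (Σ-syntax; ∃-syntax; _×_; _,_; proj₁; proj₂; uncurry)
open import Data.Rational.Base as ℚ using (ℚ; 0ℚ; 1ℚ; _/_)
import Data.Rational.Properties as ℚ
import Data.Rational.Solver as ℚ-Solver
import Data.Rational.Unnormalised.Base as ℚᵘ
import Data.Rational.Unnormalised.Properties as ℚᵘ
open import Data.Sum.Base using (_⊎_; inj₁; inj₂; [_,_])
open import Data.Sum.Properties using (inj₂-injective)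
open import Data.Vec.Base using ([]; _∷_; here; there)
open import Data.Vec.Functional as Vector using (Vector; insertAt; removeAt)
open import Data.Vec.Functional.Properties using (insertAt-lookup; insertAt-punchIn)
open import Function.Base using (_∘_; flip)
open import Function.Bundles using (_⇔_; Inverse; Equivalence; mk⇔)
open import Function.Construct.Composition using (_↔-∘_)
open import Function.Properties.Inverse using (↔-sym)
open import Level using (0ℓ)
open import Relation.Binary.Definitions using (WeaklyDecidable)
open import Relation.Binary.PropositionalEquality as ≡ using (_≡_; _≢_)
open import Relation.Nullary using (¬_; Dec; yes; no; does; contradiction)
open import Relation.Unary using (Pred)

-- If all distinct vertices were at distance 2, a zero-sum x would have energy 4n ⟨x , x⟩. The
-- target 2 β ⟨x , x⟩ is smaller by 2 ⟨x , x⟩, a loss that edges have to supply. When x sums to zero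
-- on every star, the edges to the centres supply it, because the vector sending u to the value of x
-- at its centre is then orthogonal to x. When all degrees are large, each square is weighted with
-- its transmission instead; the estimate asks for 2 Tr(v) + 3 ≤ 3n, and as Tr(v) is 2n - 2 minus
-- the degree, this reads n ≤ 2 deg(v) + 1. Equality of Cauchy reals is undecidable, so elimination
-- cannot simply pick a nonzero pivot. The dimension count only has to refute something, hence a
-- choice under double negation suffices, and the algebra is developed over an interface that asks
-- for no decision. No spectral theorem enters: the eigenvalue count itself provides a basis of each
-- eigenspace, and eigenvectors for distinct eigenvalues are orthogonal. In the converse, the count
-- 0 for K₂ comes from the large-degree estimate, without computing a spectrum.

record OrderedDomain : Set₁ where
  field
    ring : CommutativeRing 0ℓ 0ℓ
    fromInteger : ℤ.+-*-rawRing -Raw-AlmostCommutative⟶ fromCommutativeRing ring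

  open CommutativeRing ring public hiding (ring; _-_; zero)
  open _-Raw-AlmostCommutative⟶_ fromInteger public using ()
    renaming (⟦_⟧ to ι; +-homo to ι-+; *-homo to ι-*; -‿homo to ι-neg; 0-homo to ι-0; 1-homo to ι-1)

  infixl 6 _-_
  _-_ : Carrier → Carrier → Carrier
  x - y = x + - y

  field
    1≉0     : ¬ 1# ≈ 0#
    -- These two fields replace decidable equality: an equation may be proved by contradiction, and
    -- a factor may be cancelled once it is not zero, without a positive lower bound on its size.
    stable  : ∀ x → ¬ ¬ x ≈ 0# → x ≈ 0#
    cancelʳ : ∀ x y → x * y ≈ 0# → ¬ y ≈ 0# → x ≈ 0#
    Nonneg         : Carrier → Set
    nonneg-resp    : ∀ {x y} → x ≈ y → Nonneg x → Nonneg y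
    nonneg-+       : ∀ {x y} → Nonneg x → Nonneg y → Nonneg (x + y)
    nonneg-*       : ∀ {x y} → Nonneg x → Nonneg y → Nonneg (x * y)
    nonneg-square  : ∀ x → Nonneg (x * x)
    nonneg-ι       : ∀ k → Nonneg (ι (+ k))
    nonneg-antisym : ∀ x → Nonneg x → Nonneg (- x) → x ≈ 0#

-- Finite sums, order and linear systems over an ordered domain

module OrderedDomainProperties (F : OrderedDomain) where
  open OrderedDomain F public
  open SemiringSum semiring public
    using (sum; sum-cong-≋; sum-replicate-zero; sum-remove; ∑-distrib-+; ∑-comm; *-distribˡ-sum; *-distribʳ-sum)
  -- The ring solver has to compare coefficients. Ring elements cannot be compared, so it works with
  -- integer coefficients, mapped into the ring by `ι`.
  coefficient-≟ : WeaklyDecidable (Induced-equivalence fromInteger)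
  coefficient-≟ a b with a ℤ.≟ b
  ... | yes a≡b = just (reflexive (≡.cong ι a≡b))
  ... | no _    = nothing

  module Solver = RingSolver ℤ.+-*-rawRing (fromCommutativeRing ring) fromInteger coefficient-≟
  open Solver using (solve; con; _:=_; _:+_; _:*_; :-_; _:-_)
  open import Relation.Binary.Reasoning.Setoid setoid

  two : Carrier
  two = ι (+ 2)

  sum-cong : ∀ {n} {f g : Vector Carrier n} → (∀ i → f i ≈ g i) → sum f ≈ sum g
  sum-cong = sum-cong-≋

  sum-zero : ∀ {n} {f : Vector Carrier n} → (∀ i → f i ≈ 0#) → sum f ≈ 0#
  sum-zero {n} f≈0 = trans (sum-cong f≈0) (sum-replicate-zero n)

  sum-single : ∀ {n} (f : Vector Carrier n) i → (∀ j → j ≢ i → f j ≈ 0#) → sum f ≈ f i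
  sum-single {suc n} f i f≈0 = begin
    sum f                     ≈⟨ sum-remove {i = i} f ⟩
    f i + sum (removeAt f i)  ≈⟨ +-congˡ (sum-zero λ j → f≈0 _ (Fin.punchInᵢ≢i i j)) ⟩
    f i + 0#                  ≈⟨ +-identityʳ _ ⟩
    f i                       ∎

  sum-linear : ∀ {n} a b (f g : Vector Carrier n) →
    sum (λ i → a * f i + b * g i) ≈ a * sum f + b * sum g
  sum-linear a b f g = trans (∑-distrib-+ (λ i → a * f i) (λ i → b * g i))
    (sym (+-cong (*-distribˡ-sum a f) (*-distribˡ-sum b g)))

  sum-const : ∀ n x → sum {n} (λ _ → x) ≈ ι (+ n) * x
  sum-const zero    x = sym (trans (*-congʳ ι-0) (zeroˡ x))
  sum-const (suc n) x = begin
    x + sum {n} (λ _ → x)     ≈⟨ +-congˡ (sum-const n x) ⟩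
    x + ι (+ n) * x           ≈⟨ solve 2 (λ x m → x :+ m :* x := (con (+ 1) :+ m) :* x)
         refl x (ι (+ n)) ⟩
    (ι (+ 1) + ι (+ n)) * x   ≈⟨ *-congʳ (ι-+ (+ 1) (+ n)) ⟨
    ι (+ suc n) * x           ∎

  difference-zero : ∀ x y → x - y ≈ 0# → x ≈ y
  difference-zero x y x-y≈0 = begin
    x            ≈⟨ solve 2 (λ x y → x := (x :- y) :+ y) refl x y ⟩
    (x - y) + y  ≈⟨ +-congʳ x-y≈0 ⟩
    0# + y       ≈⟨ +-identityˡ y ⟩
    y            ∎

  -- Order

  infix 4 _≤_
  _≤_ : Carrier → Carrier → Set
  x ≤ y = Nonneg (y - x)

  ≤-by : ∀ {x y z} → Nonneg z → z ≈ y - x → x ≤ y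
  ≤-by z≥0 z≈y-x = nonneg-resp z≈y-x z≥0

  ≤-reflexive : ∀ {x y} → x ≈ y → x ≤ y
  ≤-reflexive {x} {y} x≈y = ≤-by (nonneg-ι 0) (begin
    ι (+ 0)  ≈⟨ ι-0 ⟩
    0#       ≈⟨ -‿inverseʳ x ⟨
    x - x    ≈⟨ +-congʳ x≈y ⟩
    y - x    ∎)

  ≤-trans : ∀ {x y z} → x ≤ y → y ≤ z → x ≤ z
  ≤-trans {x} {y} {z} x≤y y≤z = ≤-by (nonneg-+ x≤y y≤z)
    (solve 3 (λ x y z → (y :- x) :+ (z :- y) := z :- x) refl x y z)

  ≤-resp : ∀ {x y x′ y′} → x ≈ x′ → y ≈ y′ → x ≤ y → x′ ≤ y′
  ≤-resp x≈x′ y≈y′ = nonneg-resp (+-cong y≈y′ (-‿cong x≈x′))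

  nonneg-0 : Nonneg 0#
  nonneg-0 = nonneg-resp ι-0 (nonneg-ι 0)

  nonneg-sum : ∀ {n} {f : Vector Carrier n} → (∀ i → Nonneg (f i)) → Nonneg (sum f)
  nonneg-sum {zero}  f≥0 = nonneg-0
  nonneg-sum {suc n} f≥0 = nonneg-+ (f≥0 zero) (nonneg-sum (f≥0 ∘ suc))

  sum-mono : ∀ {n} {f g : Vector Carrier n} → (∀ i → f i ≤ g i) → sum f ≤ sum g
  sum-mono {f = f} {g} f≤g = nonneg-resp
    (begin
      sum (λ i → g i - f i)
        ≈⟨ sum-cong (λ i → solve 2 (λ g f → g :- f := con (+ 1) :* g :+ con (-[1+ 0 ]) :* f)
             refl (g i) (f i)) ⟩
      sum (λ i → ι (+ 1) * g i + ι -[1+ 0 ] * f i)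
        ≈⟨ sum-linear (ι (+ 1)) (ι -[1+ 0 ]) g f ⟩
      ι (+ 1) * sum g + ι -[1+ 0 ] * sum f
        ≈⟨ solve 2 (λ g f → con (+ 1) :* g :+ con (-[1+ 0 ]) :* f := g :- f) refl (sum g) (sum f) ⟩
      sum g - sum f ∎)
    (nonneg-sum f≤g)

  ι-mono : ∀ {a b} → a ℤ.≤ b → ι a ≤ ι b
  ι-mono {a} {b} a≤b with b ℤ.- a in eq | ℤ.i≤j⇒0≤j-i a≤b
  ... | + k | _ = ≤-by (nonneg-ι k) (trans (reflexive (≡.cong ι (≡.sym eq)))
                    (trans (ι-+ b (ℤ.- a)) (+-congˡ (ι-neg a))))

  nonneg-+≈0ˡ : ∀ {x y} → Nonneg x → Nonneg y → x + y ≈ 0# → x ≈ 0#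
  nonneg-+≈0ˡ {x} {y} x≥0 y≥0 x+y≈0 = nonneg-antisym x x≥0 (nonneg-resp (begin
    y            ≈⟨ solve 2 (λ x y → y := (x :+ y) :- x) refl x y ⟩
    (x + y) - x  ≈⟨ +-congʳ x+y≈0 ⟩
    0# - x       ≈⟨ +-identityˡ _ ⟩
    - x          ∎) y≥0)

  nonneg-sum≈0 : ∀ {n} {f : Vector Carrier n} → (∀ i → Nonneg (f i)) → sum f ≈ 0# → ∀ i → f i ≈ 0#
  nonneg-sum≈0 f≥0 Σ≈0 zero    = nonneg-+≈0ˡ (f≥0 zero) (nonneg-sum (f≥0 ∘ suc)) Σ≈0
  nonneg-sum≈0 f≥0 Σ≈0 (suc i) = nonneg-sum≈0 (f≥0 ∘ suc)
    (nonneg-+≈0ˡ (nonneg-sum (f≥0 ∘ suc)) (f≥0 zero) (trans (+-comm _ _) Σ≈0)) i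

  -- Cancelling x needs x to be nonzero; stability allows this to be assumed, after which the
  -- cancellation is itself the contradiction.
  square≈0 : ∀ x → x * x ≈ 0# → x ≈ 0#
  square≈0 x x²≈0 = stable x λ x≉0 → x≉0 (cancelʳ x x x²≈0 x≉0)

  -- Homogeneous linear systems

  -- The continuation `k` is used twice: the head is first offered to it as a nonzero entry, and if
  -- a proof that the head vanishes is ever supplied against this claim, `k` receives the other
  -- alternative.
  pivot : ∀ {m} (a : Vector Carrier m) → ¬ ¬ ((∀ i → a i ≈ 0#) ⊎ ∃[ i ] ¬ a i ≈ 0#)
  pivot {zero}  a k = k (inj₁ λ ())
  pivot {suc m} a k = pivot (a ∘ suc) λ where
    (inj₂ (i , aᵢ≉0)) → k (inj₂ (suc i , aᵢ≉0))
    (inj₁ as≈0) → k (inj₂ (zero , λ a₀≈0 → k (inj₁ λ where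
      zero    → a₀≈0
      (suc i) → as≈0 i)))

  NontrivialSolution : ∀ {j m} → (Fin j → Fin m → Carrier) → Set
  NontrivialSolution {j} {m} a = Σ[ c ∈ Vector Carrier m ] (∃[ l ] ¬ c l ≈ 0#) × (∀ e → sum (λ l → a e l * c l) ≈ 0#)

  -- Fraction-free Gaussian elimination; the double negation stands for the
  -- undecidable choice of a nonzero pivot.
  underdetermined : ∀ j m → j ℕ.< m → (a : Fin j → Fin m → Carrier) → ¬ ¬ NontrivialSolution a
  underdetermined zero    (suc m) _           a k = k ((λ _ → 1#) , (zero , 1≉0) , λ ())
  underdetermined (suc j) (suc m) (ℕ.s≤s j<m) a k = pivot (a zero) λ where
    (inj₁ a₀≈0) → underdetermined j (suc m) (ℕ.m<n⇒m<1+n j<m) (a ∘ suc) λ (c , nz , eq) →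
      k (c , nz , λ where
        zero    → sum-zero λ l → trans (*-congʳ (a₀≈0 l)) (zeroˡ (c l))
        (suc e) → eq e)
    (inj₂ (i , p≉0)) →
      let p        = a zero i
          rest     = λ e l → a e (punchIn i l)
          reduce   = λ e l → p * rest e l - a e i * rest zero l
      in underdetermined j m j<m (reduce ∘ suc) λ (c , (l₀ , c≉0) , eq) →
        -- Back substitution would set the pivot unknown to -s₀ / p. Multiplying the whole solution
        -- by p avoids the division, and the solution stays nontrivial because p can be cancelled.
        let s₀  = sum λ l → rest zero l * c l
            pc  = λ l → p * c l
            c′  = insertAt pc i (- s₀)
            row : ∀ e → sum (λ l → a e l * c′ l) ≈ sum (λ l → reduce e l * c l)
            row e = begin
              sum (λ l → a e l * c′ l)
                ≈⟨ sum-remove {i = i} (λ l → a e l * c′ l) ⟩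
              a e i * c′ i + sum (λ l → rest e l * c′ (punchIn i l))
                ≈⟨ +-cong (*-congˡ (reflexive (insertAt-lookup pc i (- s₀))))
                          (sum-cong λ l → *-congˡ (reflexive (insertAt-punchIn pc i (- s₀) l))) ⟩
              a e i * - s₀ + sum (λ l → rest e l * (p * c l))
                ≈⟨ +-congˡ (trans (sum-cong λ l → solve 3 (λ r p c → r :* (p :* c) := p :* (r :* c))
                     refl (rest e l) p (c l))
                                  (sym (*-distribˡ-sum p (λ l → rest e l * c l)))) ⟩
              a e i * - s₀ + p * sum (λ l → rest e l * c l)
                ≈⟨ solve 4 (λ b s p t → b :* (:- s) :+ p :* t := p :* t :+ (:- b) :* s)
                     refl (a e i) s₀ p (sum λ l → rest e l * c l) ⟩
              p * sum (λ l → rest e l * c l) + (- a e i) * s₀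
                ≈⟨ sum-linear p (- a e i) (λ l → rest e l * c l) (λ l → rest zero l * c l) ⟨
              sum (λ l → p * (rest e l * c l) + (- a e i) * (rest zero l * c l))
                ≈⟨ sum-cong (λ l → solve 5 (λ p r b q c → p :* (r :* c) :+ (:- b) :* (q :* c) :=
                     (p :* r :- b :* q) :* c)
                     refl p (rest e l) (a e i) (rest zero l) (c l)) ⟩
              sum (λ l → reduce e l * c l) ∎
        in k (c′ ,
              (punchIn i l₀ , λ c′≈0 → p≉0 (cancelʳ p (c l₀)
                 (trans (reflexive (≡.sym (insertAt-punchIn pc i (- s₀) l₀))) c′≈0) c≉0)) ,
              λ where
                zero    → trans (row zero) (sum-zero λ l →
                  trans (*-congʳ (-‿inverseʳ _)) (zeroˡ (c l)))
                (suc e) → trans (row (suc e)) (eq e))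

-- Fin (m₀ + … + mᵣ₋₁) as the disjoint union of the Fin mᵢ

total : ∀ {r} → Vector ℕ r → ℕ
total = Vector.foldr ℕ._+_ 0

place : ∀ {r} (m : Vector ℕ r) i → Fin (m i) → Fin (total m)
place m zero    q = q ↑ˡ _
place m (suc i) q = m zero ↑ʳ place (m ∘ suc) i q

locate : ∀ {r} (m : Vector ℕ r) → Fin (total m) → Σ[ i ∈ Fin r ] Fin (m i)
locate {suc r} m p with splitAt (m zero) p
... | inj₁ q  = zero , q
... | inj₂ p′ = let i , q = locate (m ∘ suc) p′ in suc i , q

locate-place : ∀ {r} (m : Vector ℕ r) i q → locate m (place m i q) ≡ (i , q)
locate-place m zero    q rewrite Fin.splitAt-↑ˡ (m zero) q (total (m ∘ suc)) = ≡.refl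
locate-place m (suc i) q
  rewrite Fin.splitAt-↑ʳ (m zero) (total (m ∘ suc)) (place (m ∘ suc) i q)
        | locate-place (m ∘ suc) i q = ≡.refl

place-locate : ∀ {r} (m : Vector ℕ r) p → uncurry (place m) (locate m p) ≡ p
place-locate {suc r} m p with splitAt (m zero) p in eq
... | inj₁ q  = Fin.splitAt⁻¹-↑ˡ eq
... | inj₂ p′ = ≡.trans (≡.cong (m zero ↑ʳ_) (place-locate (m ∘ suc) p′)) (Fin.splitAt⁻¹-↑ʳ eq)

-- Symmetric matrices: orthogonality of eigenvectors and a dimension bound

module SymmetricSpectrum (F : OrderedDomain) where
  open OrderedDomainProperties F
  open Solver using (solve; con; _:=_; _:+_; _:*_; :-_; _:-_)
  open import Relation.Binary.Reasoning.Setoid setoid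

  infixl 8 _∙_
  infixr 9 _▹_

  _∙_ : ∀ {n} → Vector Carrier n → Vector Carrier n → Carrier
  x ∙ y = sum λ u → x u * y u

  _▹_ : ∀ {n} → (Fin n → Fin n → Carrier) → Vector Carrier n → Vector Carrier n
  (M ▹ x) u = M u ∙ x

  ∙-cong : ∀ {n} {x x′ y y′ : Vector Carrier n} →
    (∀ u → x u ≈ x′ u) → (∀ u → y u ≈ y′ u) → x ∙ y ≈ x′ ∙ y′
  ∙-cong x≈x′ y≈y′ = sum-cong λ u → *-cong (x≈x′ u) (y≈y′ u)

  ∙-comm : ∀ {n} (x y : Vector Carrier n) → x ∙ y ≈ y ∙ x
  ∙-comm x y = sum-cong λ u → *-comm (x u) (y u)

  ∙-sum : ∀ {n r} (y : Vector Carrier n) (x : Fin r → Vector Carrier n) →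
    y ∙ (λ u → sum λ i → x i u) ≈ sum λ i → y ∙ x i
  ∙-sum y x = trans (sum-cong λ u → *-distribˡ-sum (y u) (λ i → x i u))
                    (∑-comm λ u i → y u * x i u)

  ∙-scale : ∀ {n} (y : Vector Carrier n) c (x : Vector Carrier n) → y ∙ (λ u → c * x u) ≈ c * (y ∙ x)
  ∙-scale y c x = trans
    (sum-cong λ u → solve 3 (λ y c x → y :* (c :* x) := c :* (y :* x)) refl (y u) c (x u))
    (sym (*-distribˡ-sum c (λ u → y u * x u)))

  ∙-combination : ∀ {n r} (y : Vector Carrier n) (c : Vector Carrier r) (x : Fin r → Vector Carrier n) →
    y ∙ (λ u → sum λ i → c i * x i u) ≈ sum λ i → c i * (y ∙ x i)
  ∙-combination y c x = trans (∙-sum y λ i u → c i * x i u)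
                              (sum-cong λ i → ∙-scale y (c i) (x i))

  x∙x-nonneg : ∀ {n} (x : Vector Carrier n) → Nonneg (x ∙ x)
  x∙x-nonneg x = nonneg-sum λ u → nonneg-square (x u)

  x∙x≈0 : ∀ {n} (x : Vector Carrier n) → x ∙ x ≈ 0# → ∀ u → x u ≈ 0#
  x∙x≈0 x x∙x≈0 u = square≈0 (x u) (nonneg-sum≈0 (λ u → nonneg-square (x u)) x∙x≈0 u)

  sum-↑ : ∀ m {n} (f : Vector Carrier (m ℕ.+ n)) →
    sum f ≈ sum (λ i → f (i ↑ˡ n)) + sum (λ j → f (m ↑ʳ j))
  sum-↑ zero    f = sym (+-identityˡ _)
  sum-↑ (suc m) f = trans (+-congˡ (sum-↑ m (f ∘ suc))) (sym (+-assoc _ _ _))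

  sum-place : ∀ {r} (m : Vector ℕ r) (f : Vector Carrier (total m)) →
    sum f ≈ sum λ i → sum λ q → f (place m i q)
  sum-place {zero}  m f = refl
  sum-place {suc r} m f = trans (sum-↑ (m zero) f) (+-congˡ (sum-place (m ∘ suc) _))

  Eigenvector : ∀ {n} → (Fin n → Fin n → Carrier) → Carrier → Vector Carrier n → Set
  Eigenvector M θ x = ∀ u → (M ▹ x) u ≈ θ * x u

  module _ {n} (M : Fin n → Fin n → Carrier) (M-sym : ∀ u v → M u v ≈ M v u) where

    self-adjoint : ∀ x y → M ▹ x ∙ y ≈ x ∙ M ▹ y
    self-adjoint x y = begin
      sum (λ u → (M u ∙ x) * y u)
        ≈⟨ sum-cong (λ u → *-distribʳ-sum (y u) (λ v → M u v * x v)) ⟩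
      sum (λ u → sum λ v → M u v * x v * y u)
        ≈⟨ ∑-comm (λ u v → M u v * x v * y u) ⟩
      sum (λ v → sum λ u → M u v * x v * y u)
        ≈⟨ sum-cong (λ v → trans
             (sum-cong λ u → trans (*-congʳ (*-congʳ (M-sym u v)))
               (solve 3 (λ m x y → m :* x :* y := x :* (m :* y)) refl (M v u) (x v) (y u)))
             (sym (*-distribˡ-sum (x v) (λ u → M v u * y u)))) ⟩
      x ∙ M ▹ y ∎

    eigenvectors-orthogonal : ∀ {θ η x y} → ¬ θ ≈ η → Eigenvector M θ x → Eigenvector M η y →
      x ∙ y ≈ 0#
    eigenvectors-orthogonal {θ} {η} {x} {y} θ≉η Mx≈θx My≈ηy =
      cancelʳ (x ∙ y) (θ - η)
        (begin
          (x ∙ y) * (θ - η)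
            ≈⟨ solve 3 (λ p t e → p :* (t :- e) := t :* p :- e :* p) refl (x ∙ y) θ η ⟩
          θ * (x ∙ y) - η * (x ∙ y)
            ≈⟨ +-cong (trans (*-congˡ (∙-comm x y)) (sym (∙-scale y θ x))) (-‿cong (sym (∙-scale x η y))) ⟩
          y ∙ (λ u → θ * x u) - x ∙ (λ u → η * y u)
            ≈⟨ +-cong (trans (∙-comm y _) (∙-cong (sym ∘ Mx≈θx) λ _ → refl))
                      (-‿cong (∙-cong (λ _ → refl) (sym ∘ My≈ηy))) ⟩
          M ▹ x ∙ y - x ∙ M ▹ y
            ≈⟨ +-congʳ (self-adjoint x y) ⟩
          x ∙ M ▹ y - x ∙ M ▹ y
            ≈⟨ -‿inverseʳ _ ⟩
          0# ∎)
        (θ≉η ∘ difference-zero θ η)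

    -- The form x ↦ x ∙ M x - β (x ∙ x) is positive definite on the span of the
    -- eigenvectors for eigenvalues above β.
    above-bound⇒zero : ∀ {r} (θ : Vector Carrier r) β →
      (∀ i j → θ i ≈ θ j → i ≡ j) → (∀ i → β ≤ θ i) → (∀ i → ¬ θ i ≈ β) →
      (x : Fin r → Vector Carrier n) → (∀ i → Eigenvector M (θ i) (x i)) →
      let X = λ u → sum λ i → x i u in
      two * (X ∙ M ▹ X) ≤ two * (β * (X ∙ X)) →
      ∀ i u → x i u ≈ 0#
    above-bound⇒zero {r} θ β distinct β≤θ θ≉β x Mx≈θx bound i =
      x∙x≈0 (x i) (cancelʳ _ _
        (trans (*-comm _ _) (nonneg-sum≈0 summand-nonneg t≈0 i))
        (θ≉β i ∘ difference-zero (θ i) β))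
      where
      X Y : Vector Carrier n
      X u = sum λ i → x i u
      Y u = sum λ i → (θ i - β) * x i u

      summand : Vector Carrier r
      summand i = (θ i - β) * (x i ∙ x i)

      t : Carrier
      t = sum summand

      summand-nonneg : ∀ i → Nonneg (summand i)
      summand-nonneg i = nonneg-* (β≤θ i) (x∙x-nonneg (x i))

      Y≈MX-βX : ∀ u → Y u ≈ (M ▹ X) u - β * X u
      Y≈MX-βX u = begin
        sum (λ i → (θ i - β) * x i u)
          ≈⟨ sum-cong (λ i → solve 3 (λ t b x → (t :- b) :* x :=
               con (+ 1) :* (t :* x) :+ (:- b) :* x)
               refl (θ i) β (x i u)) ⟩
        sum (λ i → ι (+ 1) * (θ i * x i u) + (- β) * x i u)
          ≈⟨ sum-linear (ι (+ 1)) (- β) (λ i → θ i * x i u) (λ i → x i u) ⟩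
        ι (+ 1) * sum (λ i → θ i * x i u) + (- β) * X u
          ≈⟨ +-congʳ (*-congˡ (sum-cong λ i → sym (Mx≈θx i u))) ⟩
        ι (+ 1) * sum (λ i → M u ∙ x i) + (- β) * X u
          ≈⟨ +-congʳ (*-congˡ (sym (∙-sum (M u) x))) ⟩
        ι (+ 1) * (M ▹ X) u + (- β) * X u
          ≈⟨ solve 3 (λ m b x → con (+ 1) :* m :+ (:- b) :* x := m :- b :* x)
               refl ((M ▹ X) u) β (X u) ⟩
        (M ▹ X) u - β * X u ∎

      X∙Y≈t : X ∙ Y ≈ t
      X∙Y≈t = begin
        X ∙ Y
          ≈⟨ ∙-comm X Y ⟩
        Y ∙ X
          ≈⟨ ∙-sum Y x ⟩
        sum (λ i → Y ∙ x i)
          ≈⟨ sum-cong (λ i → begin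
               Y ∙ x i
                 ≈⟨ ∙-comm Y (x i) ⟩
               x i ∙ Y
                 ≈⟨ ∙-combination (x i) (λ j → θ j - β) x ⟩
               sum (λ j → (θ j - β) * (x i ∙ x j))
                 ≈⟨ sum-single (λ j → (θ j - β) * (x i ∙ x j)) i (λ j j≢i →
                      trans (*-congˡ (eigenvectors-orthogonal
                        (λ θᵢ≈θⱼ → j≢i (≡.sym (distinct i j θᵢ≈θⱼ))) (Mx≈θx i) (Mx≈θx j)))
                        (zeroʳ _)) ⟩
               summand i ∎) ⟩
        t ∎

      X∙Y : X ∙ Y ≈ X ∙ M ▹ X - β * (X ∙ X)
      X∙Y = begin
        sum (λ u → X u * Y u)
          ≈⟨ sum-cong (λ u → trans (*-congˡ (Y≈MX-βX u))
               (solve 3 (λ x m b → x :* (m :- b :* x) :=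
                    con (+ 1) :* (x :* m) :+ (:- b) :* (x :* x))
                    refl (X u) ((M ▹ X) u) β)) ⟩
        sum (λ u → ι (+ 1) * (X u * (M ▹ X) u) + (- β) * (X u * X u))
          ≈⟨ sum-linear (ι (+ 1)) (- β) (λ u → X u * (M ▹ X) u) (λ u → X u * X u) ⟩
        ι (+ 1) * (X ∙ M ▹ X) + (- β) * (X ∙ X)
          ≈⟨ solve 3 (λ m b x → con (+ 1) :* m :+ (:- b) :* x := m :- b :* x)
               refl (X ∙ M ▹ X) β (X ∙ X) ⟩
        X ∙ M ▹ X - β * (X ∙ X) ∎

      t≈0 : t ≈ 0#
      -- By orthogonality t is the excess X ∙ M ▹ X - β (X ∙ X), so the bound says that -2t is
      -- nonnegative. Adding t to it gives -t, which avoids halving.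
      t≈0 = nonneg-antisym t (nonneg-sum summand-nonneg) (nonneg-resp
        (begin
          t + (two * (β * (X ∙ X)) - two * (X ∙ M ▹ X))
            ≈⟨ solve 3 (λ t b m → t :+ (con (+ 2) :* b :- con (+ 2) :* m) :=
                 t :- con (+ 2) :* (m :- b))
                 refl t (β * (X ∙ X)) (X ∙ M ▹ X) ⟩
          t - two * (X ∙ M ▹ X - β * (X ∙ X))
            ≈⟨ +-congˡ (-‿cong (*-congˡ (trans (sym X∙Y) X∙Y≈t))) ⟩
          t - two * t
            ≈⟨ solve 1 (λ t → t :- con (+ 2) :* t := :- t) refl t ⟩
          - t ∎)
        (nonneg-+ (nonneg-sum summand-nonneg) bound))

    module _ (col-sum : ∀ v → sum (λ u → M u v) ≈ 0#) where

      -- Adding up the coordinates of the eigenvector equation leaves only the vanishing column sums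
      -- on the matrix side. Zero sum is thus automatic and does not use up one of the linear
      -- equations later.
      eigenvector-sum≈0 : ∀ {θ x} → ¬ θ ≈ 0# → Eigenvector M θ x → sum x ≈ 0#
      eigenvector-sum≈0 {θ} {x} θ≉0 Mx≈θx = cancelʳ (sum x) θ
        (begin
          sum x * θ
            ≈⟨ *-comm _ _ ⟩
          θ * sum x
            ≈⟨ *-distribˡ-sum θ x ⟩
          sum (λ u → θ * x u)
            ≈⟨ sum-cong (sym ∘ Mx≈θx) ⟩
          sum (λ u → sum λ v → M u v * x v)
            ≈⟨ ∑-comm (λ u v → M u v * x v) ⟩
          sum (λ v → sum λ u → M u v * x v)
            ≈⟨ sum-zero (λ v → trans (sym (*-distribʳ-sum (x v) (λ u → M u v)))
                                     (trans (*-congʳ (col-sum v)) (zeroˡ (x v)))) ⟩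
          0# ∎)
        θ≉0

      -- With fewer equations than basis vectors, some nontrivial combination X satisfies all the
      -- equations. Grouped by eigenvalue, its components vanish by `above-bound⇒zero`, and
      -- independence inside each eigenspace then makes every coefficient vanish.
      eigenspaces-too-large : ∀ {r} (θ : Vector Carrier r) β → Nonneg β →
        (∀ i j → θ i ≈ θ j → i ≡ j) → (∀ i → β ≤ θ i) → (∀ i → ¬ θ i ≈ β) →
        (m : Vector ℕ r) (b : ∀ i → Fin (m i) → Vector Carrier n) →
        (∀ i q → Eigenvector M (θ i) (b i q)) →
        (∀ i (c : Vector Carrier (m i)) → (∀ u → sum (λ q → c q * b i q u) ≈ 0#) → ∀ q → c q ≈ 0#) →
        ∀ {j} (e : Fin j → Vector Carrier n) → j ℕ.< total m →
        ¬ (∀ x → sum x ≈ 0# → (∀ l → e l ∙ x ≈ 0#) → two * (x ∙ M ▹ x) ≤ two * (β * (x ∙ x)))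
      eigenspaces-too-large {r} θ β β≥0 distinct β≤θ θ≉β m b Mb≈θb independent {j} e j<m bound =
        underdetermined j (total m) j<m (λ l p → e l ∙ flat p) contra
        where
        flat : Fin (total m) → Vector Carrier n
        flat p = uncurry b (locate m p)

        θ≉0 : ∀ i → ¬ θ i ≈ 0#
        θ≉0 i θ≈0 = θ≉β i (trans θ≈0 (sym (nonneg-antisym β β≥0
          (nonneg-resp (trans (+-congʳ θ≈0) (+-identityˡ _)) (β≤θ i)))))

        contra : ¬ NontrivialSolution (λ l p → e l ∙ flat p)
        contra (c , (p , c≉0) , eq) = c≉0 (≡.subst (λ p → c p ≈ 0#) (place-locate m p)
          (independent i (λ q → c (place m i q))
            (above-bound⇒zero θ β distinct β≤θ θ≉β x Mx≈θx (bound X X-sum eX≈0) i) q))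
          where
          i = proj₁ (locate m p)
          q = proj₂ (locate m p)

          x : Fin r → Vector Carrier n
          x i u = sum λ q → c (place m i q) * b i q u

          X : Vector Carrier n
          X u = sum λ i → x i u

          Mx≈θx : ∀ i → Eigenvector M (θ i) (x i)
          Mx≈θx i u = begin
            M u ∙ x i
              ≈⟨ ∙-combination (M u) (λ q → c (place m i q)) (b i) ⟩
            sum (λ q → c (place m i q) * (M u ∙ b i q))
              ≈⟨ sum-cong (λ q → trans (*-congˡ (Mb≈θb i q u))
                   (solve 3 (λ c t b → c :* (t :* b) := t :* (c :* b))
                        refl (c (place m i q)) (θ i) (b i q u))) ⟩
            sum (λ q → θ i * (c (place m i q) * b i q u))
              ≈⟨ *-distribˡ-sum (θ i) (λ q → c (place m i q) * b i q u) ⟨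
            θ i * x i u ∎

          X-sum : sum X ≈ 0#
          X-sum = trans (∑-comm λ u i → x i u)
            (sum-zero λ i → eigenvector-sum≈0 (θ≉0 i) (Mx≈θx i))

          X≈flat : ∀ u → X u ≈ sum λ p → c p * flat p u
          X≈flat u = sym (trans (sum-place m λ p → c p * flat p u)
            (sum-cong λ i → sum-cong λ q →
              *-congˡ (reflexive (≡.cong (λ iq → uncurry b iq u) (locate-place m i q)))))

          eX≈0 : ∀ l → e l ∙ X ≈ 0#
          eX≈0 l = begin
            e l ∙ X
              ≈⟨ ∙-cong {x = e l} (λ _ → refl) X≈flat ⟩
            e l ∙ (λ u → sum λ p → c p * flat p u)
              ≈⟨ ∙-combination (e l) c flat ⟩
            sum (λ p → c p * (e l ∙ flat p))
              ≈⟨ ∙-comm c (λ p → e l ∙ flat p) ⟩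
            sum (λ p → (e l ∙ flat p) * c p)
              ≈⟨ eq l ⟩
            0# ∎

-- The quadratic form of the distance Laplacian and its two upper bounds

indicator : ∀ {P : Set} → Dec P → ℕ
indicator P? = if does P? then 1 else 0

indicator-yes : ∀ {P : Set} (P? : Dec P) → P → indicator P? ≡ 1
indicator-yes (yes _) _ = ≡.refl
indicator-yes (no ¬p) p = contradiction p ¬p

indicator-no : ∀ {P : Set} (P? : Dec P) → ¬ P → indicator P? ≡ 0
indicator-no (yes p) ¬p = contradiction p ¬p
indicator-no (no _)  _  = ≡.refl

module DistanceForm (F : OrderedDomain) {n} (d : Fin n → Fin n → ℕ)
  (d-sym : ∀ u v → d u v ≡ d v u) (d-refl : ∀ u → d u u ≡ 0) where

  open OrderedDomainProperties F
  open SymmetricSpectrum F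
  open Solver using (solve; con; _:=_; _:+_; _:*_; :-_; _:-_)
  open import Relation.Binary.Reasoning.Setoid setoid

  transmissions : Fin n → ℕ
  transmissions v = total λ u → d u v

  -- The formula follows `distanceLaplacian` literally, with `ι` for `fromℤ`, so that over ℝ the two
  -- agree by computation; see `L≡M`.
  M : Fin n → Fin n → Carrier
  M u v = ι ((if does (u Fin.≟ v) then + transmissions u else + 0) ℤ.- + d u v)

  β : Carrier
  β = ι (+ (2 ℕ.* n) ℤ.- 1ℤ)

  N : Carrier
  N = ι (+ n)

  D : Fin n → Fin n → Carrier
  D u v = ι (+ d u v)

  sq : Carrier → Carrier
  sq a = a * a

  sum₂ : (Fin n → Fin n → Carrier) → Carrier
  sum₂ f = sum λ u → sum (f u)

  sum₂-cong : ∀ {f g : Fin n → Fin n → Carrier} → (∀ u v → f u v ≈ g u v) → sum₂ f ≈ sum₂ g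
  sum₂-cong f≈g = sum-cong λ u → sum-cong (f≈g u)

  sum₂-mono : ∀ {f g : Fin n → Fin n → Carrier} → (∀ u v → f u v ≤ g u v) → sum₂ f ≤ sum₂ g
  sum₂-mono f≤g = sum-mono λ u → sum-mono (f≤g u)

  infixr 6 _⊕_
  infixr 7 _⊙_

  -- Together with `_⊙_` this evaluates a double sum along the syntax of its summand: the proof term
  -- has the shape of the formula.
  _⊕_ : ∀ {f g p q} → sum₂ f ≈ p → sum₂ g ≈ q → sum₂ (λ u v → f u v + g u v) ≈ p + q
  _⊕_ {f} {g} f≈p g≈q = trans
    (trans (sum-cong λ u → ∑-distrib-+ (f u) (g u)) (∑-distrib-+ (λ u → sum (f u)) (λ u → sum (g u))))
    (+-cong f≈p g≈q)

  _⊙_ : ∀ {f p} a → sum₂ f ≈ p → sum₂ (λ u v → a * f u v) ≈ a * p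
  _⊙_ {f} a f≈p = trans
    (trans (sum-cong λ u → sym (*-distribˡ-sum a (f u))) (sym (*-distribˡ-sum a (λ u → sum (f u)))))
    (*-congˡ f≈p)

  sum₂-rows : ∀ (K : Fin n → Fin n → Carrier) (y : Vector Carrier n) →
    sum₂ (λ u v → K u v * y u) ≈ sum λ u → sum (K u) * y u
  sum₂-rows K y = sum-cong λ u → sym (*-distribʳ-sum (y u) (K u))

  sum₂-columns : ∀ (K : Fin n → Fin n → Carrier) (y : Vector Carrier n) →
    sum₂ (λ u v → K u v * y v) ≈ sum λ v → sum (λ u → K u v) * y v
  sum₂-columns K y = trans (∑-comm λ u v → K u v * y v) (sum₂-rows (flip K) y)

  sum-ι : ∀ {k} (f : Vector ℕ k) → sum (λ i → ι (+ f i)) ≈ ι (+ total f)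
  sum-ι {zero}  f = sym ι-0
  sum-ι {suc k} f = trans (+-congˡ (sum-ι (f ∘ suc))) (sym (ι-+ (+ f zero) (+ total (f ∘ suc))))

  ι-difference : ∀ a b → ι (a ℤ.- b) ≈ ι a - ι b
  ι-difference a b = trans (ι-+ a (ℤ.- b)) (+-congˡ (ι-neg b))

  β≈2N-1 : β ≈ two * N - ι (+ 1)
  β≈2N-1 = trans (ι-difference (+ (2 ℕ.* n)) 1ℤ)
    (+-congʳ (trans (reflexive (≡.cong ι (ℤ.pos-* 2 n))) (ι-* (+ 2) (+ n))))

  M-sym : ∀ u v → M u v ≈ M v u
  M-sym u v with u Fin.≟ v | v Fin.≟ u
  ... | yes ≡.refl | yes _   = refl
  ... | yes ≡.refl | no v≢v  = contradiction ≡.refl v≢v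
  ... | no u≢u     | yes ≡.refl = contradiction ≡.refl u≢u
  ... | no _       | no _    = reflexive (≡.cong (λ k → ι (+ 0 ℤ.- + k)) (d-sym u v))

  M-col-sum : ∀ v → sum (λ u → M u v) ≈ 0#
  M-col-sum v = begin
    sum (λ u → M u v)
      ≈⟨ sum-cong (λ u → trans (ι-difference (diagonal u) (+ d u v))
           (solve 2 (λ a b → a :- b := con (+ 1) :* a :+ con (-[1+ 0 ]) :* b)
                refl (ι (diagonal u)) (D u v))) ⟩
    sum (λ u → ι (+ 1) * ι (diagonal u) + ι -[1+ 0 ] * D u v)
      ≈⟨ sum-linear (ι (+ 1)) (ι -[1+ 0 ]) (ι ∘ diagonal) (λ u → D u v) ⟩
    ι (+ 1) * sum (ι ∘ diagonal) + ι -[1+ 0 ] * sum (λ u → D u v)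
      ≈⟨ +-cong (*-congˡ (trans (sum-single (ι ∘ diagonal) v off-diagonal) on-diagonal))
                (*-congˡ (sum-ι λ u → d u v)) ⟩
    ι (+ 1) * ι (+ transmissions v) + ι -[1+ 0 ] * ι (+ transmissions v)
      ≈⟨ solve 1 (λ t → con (+ 1) :* t :+ con (-[1+ 0 ]) :* t := con (+ 0))
           refl (ι (+ transmissions v)) ⟩
    ι (+ 0)
      ≈⟨ ι-0 ⟩
    0# ∎
    where
    diagonal : Fin n → ℤ
    diagonal u = if does (u Fin.≟ v) then + transmissions u else + 0

    off-diagonal : ∀ u → u ≢ v → ι (diagonal u) ≈ 0#
    off-diagonal u u≢v with u Fin.≟ v
    ... | yes u≡v = contradiction u≡v u≢v
    ... | no _    = ι-0

    on-diagonal : ι (diagonal v) ≈ ι (+ transmissions v)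
    on-diagonal with v Fin.≟ v
    ... | yes _  = refl
    ... | no v≢v = contradiction ≡.refl v≢v

  energy : Vector Carrier n → Carrier
  energy x = sum₂ λ u v → D u v * sq (x u - x v)

  -- Off the diagonal D is -M, and on the diagonal the expansion of the square cancels whatever the
  -- entry is. So M may replace D everywhere, and the pure squares then carry the row and column
  -- sums of M, which are zero.
  energy-M : ∀ x → energy x ≈ two * (x ∙ M ▹ x)
  energy-M x = begin
    energy x
      ≈⟨ sum₂-cong expand ⟩
    sum₂ (λ u v → two * (x u * (M u v * x v)) +
                  (ι -[1+ 0 ] * (M u v * sq (x u)) + ι -[1+ 0 ] * (M u v * sq (x v))))
      ≈⟨ two ⊙ refl ⊕ ι -[1+ 0 ] ⊙ rows≈0 ⊕ ι -[1+ 0 ] ⊙ columns≈0 ⟩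
    two * sum₂ (λ u v → x u * (M u v * x v)) + (ι -[1+ 0 ] * 0# + ι -[1+ 0 ] * 0#)
      ≈⟨ +-cong (*-congˡ (sum-cong λ u → sym (*-distribˡ-sum (x u) (λ v → M u v * x v))))
                (trans (+-cong (zeroʳ _) (zeroʳ _)) (+-identityˡ 0#)) ⟩
    two * (x ∙ M ▹ x) + 0#
      ≈⟨ +-identityʳ _ ⟩
    two * (x ∙ M ▹ x) ∎
    where
    expand : ∀ u v → D u v * sq (x u - x v) ≈
      two * (x u * (M u v * x v)) + (ι -[1+ 0 ] * (M u v * sq (x u)) + ι -[1+ 0 ] * (M u v * sq (x v)))
    expand u v with u Fin.≟ v
    ... | yes ≡.refl = solve 3 (λ a m x → a :* ((x :- x) :* (x :- x)) :=
            con (+ 2) :* (x :* (m :* x)) :+ (con (-[1+ 0 ]) :* (m :* (x :* x)) :+ con (-[1+ 0 ]) :* (m :* (x :* x))))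
            refl (D u u) (ι (+ transmissions u ℤ.- + d u u)) (x u)
    ... | no _ = begin
      D u v * sq (x u - x v)
        ≈⟨ solve 3 (λ a x y → a :* ((x :- y) :* (x :- y)) :=
             con (+ 2) :* (x :* ((con (+ 0) :- a) :* y)) :+
               (con (-[1+ 0 ]) :* ((con (+ 0) :- a) :* (x :* x)) :+ con (-[1+ 0 ]) :* ((con (+ 0) :- a) :* (y :* y))))
             refl (D u v) (x u) (x v) ⟩
      rhs (ι (+ 0) - D u v)
        ≈⟨ +-cong (*-congˡ (*-congˡ (*-congʳ m≈))) (+-cong (*-congˡ (*-congʳ m≈)) (*-congˡ (*-congʳ m≈))) ⟩
      rhs (ι (+ 0 ℤ.- + d u v)) ∎
      where
      rhs : Carrier → Carrier
      rhs m = two * (x u * (m * x v)) + (ι -[1+ 0 ] * (m * sq (x u)) + ι -[1+ 0 ] * (m * sq (x v)))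
      m≈ : ι (+ 0) - D u v ≈ ι (+ 0 ℤ.- + d u v)
      m≈ = sym (ι-difference (+ 0) (+ d u v))

    vanish : (k : Vector Carrier n) → (∀ u → k u ≈ 0#) → sum (λ u → k u * sq (x u)) ≈ 0#
    vanish k k≈0 = sum-zero λ u → trans (*-congʳ (k≈0 u)) (zeroˡ _)

    rows≈0 : sum₂ (λ u v → M u v * sq (x u)) ≈ 0#
    rows≈0 = trans (sum₂-rows M (sq ∘ x))
      (vanish (λ u → sum (M u)) λ u → trans (sum-cong (M-sym u)) (M-col-sum u))

    columns≈0 : sum₂ (λ u v → M u v * sq (x v)) ≈ 0#
    columns≈0 = trans (sum₂-columns M (sq ∘ x)) (vanish (λ v → sum λ u → M u v) M-col-sum)

  starVector : ∀ {k} → (Fin n → Fin k) → Fin k → Vector Carrier n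
  starVector g i u = ι (+ indicator (g u Fin.≟ i))

  module _ (x : Vector Carrier n) (x-sum : sum x ≈ 0#) where

    σ : Carrier
    σ = x ∙ x

    sum₂-squareˡ : sum₂ (λ u v → sq (x u)) ≈ N * σ
    sum₂-squareˡ = trans (sum-cong λ u → sum-const n (sq (x u))) (sym (*-distribˡ-sum N (sq ∘ x)))

    sum₂-squareʳ : sum₂ (λ u v → sq (x v)) ≈ N * σ
    sum₂-squareʳ = sum-const n σ

    sum₂-mixed : sum₂ (λ u v → x u * x v) ≈ 0#
    sum₂-mixed = sum-zero λ u → trans (sym (*-distribˡ-sum (x u) x)) (trans (*-congˡ x-sum) (zeroʳ _))

    -- From D (a - b)² ≤ 2 D (a² + b²) - (a + b)², valid as D ≥ 1 off the diagonal.
    small-transmission-bound : (∀ u v → u ≢ v → 1 ℕ.≤ d u v) →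
      (∀ u → 2 ℕ.* transmissions u ℕ.+ 3 ℕ.≤ 3 ℕ.* n) → energy x ≤ two * (β * σ)
    small-transmission-bound d≥1 T-bound = ≤-trans (sum₂-mono pointwise) (≤-resp (sym sum₂-g) refl sum-bound)
      where
      -- For u = v the distance is 0, and the term -(a + b)² contributes -4 (x u)² although the
      -- energy there is 0. Four copies of `diagonal` compensate for this.
      diagonal : Fin n → Fin n → Carrier
      diagonal u v = ι (+ indicator (u Fin.≟ v)) * sq (x u)

      g : Fin n → Fin n → Carrier
      g u v = two * (D u v * sq (x u)) + (two * (D u v * sq (x v)) +
        (ι -[1+ 0 ] * sq (x u) + (ι -[1+ 0 ] * sq (x v) + (ι -[1+ 1 ] * (x u * x v) + ι (+ 4) * diagonal u v))))

      pointwise : ∀ u v → D u v * sq (x u - x v) ≤ g u v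
      pointwise u v with u Fin.≟ v
      ... | yes ≡.refl = ≤-by (nonneg-ι 0) (begin
        ι (+ 0)
          ≈⟨ solve 1 (λ x → con (+ 0) := rhs (con (+ 0)) (con (+ 1)) x x) refl (x u) ⟩
        _
          ≈⟨ reflexive (≡.cong (λ k → value (ι (+ k))) (≡.sym (d-refl u))) ⟩
        value (D u u) ∎)
        where
        rhs = λ {k} (D e x y : Solver.Polynomial k) →
          (con (+ 2) :* (D :* (x :* x)) :+ (con (+ 2) :* (D :* (y :* y)) :+
            (con (-[1+ 0 ]) :* (x :* x) :+ (con (-[1+ 0 ]) :* (y :* y) :+ (con (-[1+ 1 ]) :* (x :* y) :+ con (+ 4) :* (e :* (x :* x)))))))
          :- D :* ((x :- y) :* (x :- y))
        value : Carrier → Carrier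
        value D = two * (D * sq (x u)) + (two * (D * sq (x u)) +
          (ι -[1+ 0 ] * sq (x u) + (ι -[1+ 0 ] * sq (x u) + (ι -[1+ 1 ] * (x u * x u) + ι (+ 4) * (ι (+ 1) * sq (x u)))))) - D * sq (x u - x u)
      ... | no u≢v = ≤-by (nonneg-* (ι-mono (ℤ.+≤+ (d≥1 u v u≢v))) (nonneg-square (x u + x v)))
        (solve 3 (λ D x y → (D :- con (+ 1)) :* ((x :+ y) :* (x :+ y)) :=
          (con (+ 2) :* (D :* (x :* x)) :+ (con (+ 2) :* (D :* (y :* y)) :+
            (con (-[1+ 0 ]) :* (x :* x) :+ (con (-[1+ 0 ]) :* (y :* y) :+ (con (-[1+ 1 ]) :* (x :* y) :+ con (+ 4) :* (con (+ 0) :* (x :* x)))))))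
          :- D :* ((x :- y) :* (x :- y))) refl (D u v) (x u) (x v))

      τ : Carrier
      τ = sum λ u → ι (+ transmissions u) * sq (x u)

      sum₂-g : sum₂ g ≈ two * τ + (two * τ +
        (ι -[1+ 0 ] * (N * σ) + (ι -[1+ 0 ] * (N * σ) + (ι -[1+ 1 ] * 0# + ι (+ 4) * σ))))
      sum₂-g = two ⊙ rows ⊕ two ⊙ columns ⊕ ι -[1+ 0 ] ⊙ sum₂-squareˡ ⊕ ι -[1+ 0 ] ⊙ sum₂-squareʳ
        ⊕ ι -[1+ 1 ] ⊙ sum₂-mixed ⊕ ι (+ 4) ⊙ sum₂-diagonal
        where
        columns : sum₂ (λ u v → D u v * sq (x v)) ≈ τ
        columns = trans (sum₂-columns D (sq ∘ x)) (sum-cong λ v → *-congʳ (sum-ι λ u → d u v))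

        rows : sum₂ (λ u v → D u v * sq (x u)) ≈ τ
        rows = trans (sum₂-rows D (sq ∘ x)) (sum-cong λ u → *-congʳ (trans
          (sum-cong λ v → reflexive (≡.cong (ι ∘ +_) (d-sym u v))) (sum-ι λ v → d v u)))

        sum₂-diagonal : sum₂ diagonal ≈ σ
        sum₂-diagonal = sum-cong λ u → trans
          (sum-single (diagonal u) u λ v v≢u → trans (*-congʳ (trans
            (reflexive (≡.cong (ι ∘ +_) (indicator-no (u Fin.≟ v) (v≢u ∘ ≡.sym)))) ι-0)) (zeroˡ _))
          (trans (*-congʳ (trans (reflexive (≡.cong (ι ∘ +_) (indicator-yes (u Fin.≟ u) ≡.refl))) ι-1)) (*-identityˡ _))

      -- The sum of g is 4τ - 2Nσ + 4σ, and 2βσ is 4Nσ - 2σ. Their difference is 2 ((3N - 3) σ -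
      -- 2τ), which is twice the sum of `slack u` times (x u)². This is the origin of the hypothesis
      -- 2 Tr(u) + 3 ≤ 3n.
      slack : Vector Carrier n
      slack u = ι (+ (3 ℕ.* n)) - ι (+ (2 ℕ.* transmissions u ℕ.+ 3))

      sum-bound : _ ≤ two * (β * σ)
      sum-bound = ≤-by
        (nonneg-* (nonneg-ι 2) (nonneg-sum λ u → nonneg-* (ι-mono (ℤ.+≤+ (T-bound u))) (nonneg-square (x u))))
        (begin
          two * sum (λ u → slack u * sq (x u))
            ≈⟨ *-congˡ (sum-cong λ u → trans (*-congʳ (slack-form u))
                 (solve 3 (λ N t s → (con (+ 3) :* N :- (con (+ 2) :* t :+ con (+ 3))) :* s :=
                   (con (+ 3) :* N :- con (+ 3)) :* s :+ con (-[1+ 1 ]) :* (t :* s)) refl N (ι (+ transmissions u)) (sq (x u)))) ⟩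
          two * sum (λ u → (ι (+ 3) * N - ι (+ 3)) * sq (x u) + ι -[1+ 1 ] * (ι (+ transmissions u) * sq (x u)))
            ≈⟨ *-congˡ (sum-linear (ι (+ 3) * N - ι (+ 3)) (ι -[1+ 1 ]) (sq ∘ x) (λ u → ι (+ transmissions u) * sq (x u))) ⟩
          two * ((ι (+ 3) * N - ι (+ 3)) * σ + ι -[1+ 1 ] * τ)
            ≈⟨ solve 3 (λ N s t → con (+ 2) :* ((con (+ 3) :* N :- con (+ 3)) :* s :+ con (-[1+ 1 ]) :* t) :=
                 con (+ 2) :* ((con (+ 2) :* N :- con (+ 1)) :* s) :-
                 (con (+ 2) :* t :+ (con (+ 2) :* t :+ (con (-[1+ 0 ]) :* (N :* s) :+ (con (-[1+ 0 ]) :* (N :* s) :+ (con (-[1+ 1 ]) :* con (+ 0) :+ con (+ 4) :* s))))))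
                 refl N σ τ ⟩
          two * ((two * N - ι (+ 1)) * σ) - rhs (ι (+ 0))
            ≈⟨ +-cong (*-congˡ (*-congʳ (sym β≈2N-1))) (-‿cong (+-congˡ (+-congˡ (+-congˡ (+-congˡ (+-congʳ (*-congˡ ι-0))))))) ⟩
          two * (β * σ) - rhs 0# ∎)
        where
        rhs : Carrier → Carrier
        rhs z = two * τ + (two * τ +
          (ι -[1+ 0 ] * (N * σ) + (ι -[1+ 0 ] * (N * σ) + (ι -[1+ 1 ] * z + ι (+ 4) * σ))))

        slack-form : ∀ u → slack u ≈ ι (+ 3) * N - (two * ι (+ transmissions u) + ι (+ 3))
        slack-form u = +-cong
          (trans (reflexive (≡.cong ι (ℤ.pos-* 3 n))) (ι-* (+ 3) (+ n)))
          (-‿cong (trans (ι-+ (+ (2 ℕ.* transmissions u)) (+ 3))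
            (+-congʳ (trans (reflexive (≡.cong ι (ℤ.pos-* 2 (transmissions u)))) (ι-* (+ 2) (+ transmissions u))))))

    -- A partition of the vertices into stars: u lies in the star centred at c (g u).
    module _ {j} (c : Fin (suc j) → Fin n) (g : Fin n → Fin (suc j)) where

      centre : Fin n → Fin n
      centre u = c (g u)

      star-other : ∀ u {i} → g u ≢ i → starVector g i u ≈ 0#
      star-other u {i} gu≢i = trans (reflexive (≡.cong (ι ∘ +_) (indicator-no (g u Fin.≟ i) gu≢i))) ι-0

      star-own : ∀ u → starVector g (g u) u ≈ 1#
      star-own u = trans (reflexive (≡.cong (ι ∘ +_) (indicator-yes (g u Fin.≟ g u) ≡.refl))) ι-1

      module _ (star-sums : ∀ i → starVector g (suc i) ∙ x ≈ 0#) where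

        -- Each vertex lies in exactly one star, so the star sums add up to the sum of x, which is
        -- zero.
        all-star-sums : ∀ i → starVector g i ∙ x ≈ 0#
        all-star-sums (suc i) = star-sums i
        all-star-sums zero    = begin
          starVector g zero ∙ x
            ≈⟨ +-identityʳ _ ⟨
          starVector g zero ∙ x + 0#
            ≈⟨ +-congˡ (sum-zero star-sums) ⟨
          sum (λ i → starVector g i ∙ x)
            ≈⟨ ∑-comm (λ i u → starVector g i u * x u) ⟩
          sum (λ u → sum λ i → starVector g i u * x u)
            ≈⟨ sum-cong (λ u → trans
                 (sum-single (λ i → starVector g i u * x u) (g u) λ i i≢gu →
                   trans (*-congʳ (star-other u (i≢gu ∘ ≡.sym))) (zeroˡ _))
                 (trans (*-congʳ (star-own u)) (*-identityˡ _))) ⟩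
          sum x
            ≈⟨ x-sum ⟩
          0# ∎

        -- On each star the factor x (centre u) is constant, so the star contributes that constant
        -- times its own sum, which is zero.
        x∙centre≈0 : x ∙ (x ∘ centre) ≈ 0#
        x∙centre≈0 = begin
          x ∙ (x ∘ centre)
            ≈⟨ ∙-cong {x = x} (λ _ → refl) (λ u → sym (trans
                 (sum-single (λ i → x (c i) * starVector g i u) (g u) λ i i≢gu →
                   trans (*-congˡ (star-other u (i≢gu ∘ ≡.sym))) (zeroʳ _))
                 (trans (*-congˡ (star-own u)) (*-identityʳ _)))) ⟩
          x ∙ (λ u → sum λ i → x (c i) * starVector g i u)
            ≈⟨ ∙-combination x (x ∘ c) (starVector g) ⟩
          sum (λ i → x (c i) * (x ∙ starVector g i))
            ≈⟨ sum-zero (λ i → trans (*-congˡ (trans (∙-comm x (starVector g i)) (all-star-sums i))) (zeroʳ (x (c i)))) ⟩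
          0# ∎

        spoke-energy : Carrier
        spoke-energy = sum λ u → sq (x u - x (centre u))

        -- This is Pythagoras for x and y = x ∘ centre: as they are orthogonal, the spoke energy is
        -- x ∙ x + y ∙ y.
        σ≤spoke-energy : σ ≤ spoke-energy
        σ≤spoke-energy = ≤-by (x∙x-nonneg (x ∘ centre)) (begin
          y ∙ y
            ≈⟨ solve 2 (λ s t → t :=
                 (con (+ 1) :* s :+ con (+ 1) :* (con (+ 1) :* t :+ con (-[1+ 1 ]) :* con (+ 0))) :- s)
                 refl σ (y ∙ y) ⟩
          (ι (+ 1) * σ + ι (+ 1) * (ι (+ 1) * (y ∙ y) + ι -[1+ 1 ] * ι (+ 0))) - σ
            ≈⟨ +-congʳ (+-congˡ (*-congˡ (+-congˡ (*-congˡ (trans ι-0 (sym x∙centre≈0)))))) ⟩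
          (ι (+ 1) * σ + ι (+ 1) * (ι (+ 1) * (y ∙ y) + ι -[1+ 1 ] * (x ∙ y))) - σ
            ≈⟨ +-congʳ (+-congˡ (*-congˡ (sym (sum-linear (ι (+ 1)) (ι -[1+ 1 ]) (sq ∘ y) (λ u → x u * y u))))) ⟩
          (ι (+ 1) * σ + ι (+ 1) * sum (λ u → ι (+ 1) * sq (y u) + ι -[1+ 1 ] * (x u * y u))) - σ
            ≈⟨ +-congʳ (sym (sum-linear (ι (+ 1)) (ι (+ 1)) (sq ∘ x) (λ u → ι (+ 1) * sq (y u) + ι -[1+ 1 ] * (x u * y u)))) ⟩
          sum (λ u → ι (+ 1) * sq (x u) + ι (+ 1) * (ι (+ 1) * sq (y u) + ι -[1+ 1 ] * (x u * y u))) - σ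
            ≈⟨ +-congʳ (sum-cong λ u → solve 2 (λ x y → con (+ 1) :* (x :* x) :+ con (+ 1) :* (con (+ 1) :* (y :* y) :+ con (-[1+ 1 ]) :* (x :* y)) :=
                 (x :- y) :* (x :- y))
                 refl (x u) (y u)) ⟩
          spoke-energy - σ ∎)
          where
          y = x ∘ centre

        -- The spokes are edges, so off the diagonal 2 - D dominates the
        -- indicator of the pairs (u , centre u) and (centre u , u).
        star-bound : (∀ i → centre (c i) ≡ c i) →
          (∀ u → u ≡ centre u ⊎ d u (centre u) ≡ 1) → (∀ u v → d u v ℕ.≤ 2) →
          -- With E the energy and k the spoke energy, `total-bound` below gives E + 2k ≤ 4Nσ, and k
          -- ≥ σ then gives E ≤ (4N - 2) σ = 2βσ. The intermediate term of the transitivity is 2βσ +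
          -- (E + 2k) - 4Nσ.
          energy x ≤ two * (β * σ)
        star-bound centre-c near d≤2 = ≤-trans
          (≤-by (nonneg-* (nonneg-ι 2) σ≤spoke-energy)
            (solve 4 (λ E N s k → con (+ 2) :* (k :- s) :=
              ((con (+ 2) :* ((con (+ 2) :* N :- con (+ 1)) :* s)) :+ (E :+ (k :+ k)) :- con (+ 4) :* (N :* s)) :- E)
              refl (energy x) N σ spoke-energy))
          (≤-by total-bound
            (trans (solve 4 (λ E N s k → con (+ 4) :* (N :* s) :- (E :+ (k :+ k)) :=
              con (+ 2) :* ((con (+ 2) :* N :- con (+ 1)) :* s) :-
              ((con (+ 2) :* ((con (+ 2) :* N :- con (+ 1)) :* s)) :+ (E :+ (k :+ k)) :- con (+ 4) :* (N :* s)))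
              refl (energy x) N σ spoke-energy)
              (+-congʳ (*-congˡ (*-congʳ (sym β≈2N-1))))))
          where
          p : Fin n → Fin n → ℕ
          p u v = indicator (v Fin.≟ centre u)

          spoke : Fin n → Fin n → Carrier
          spoke u v = ι (+ p u v) * sq (x u - x v)

          near-edge : ∀ {u v} → u ≢ v → v ≡ centre u → d u v ≡ 1
          near-edge {u} u≢v ≡.refl with near u
          ... | inj₁ u≡cu = contradiction u≡cu u≢v
          ... | inj₂ du≡1 = du≡1

          d+p+p≤2 : ∀ {u v} → u ≢ v → d u v ℕ.+ (p u v ℕ.+ p v u) ℕ.≤ 2
          d+p+p≤2 {u} {v} u≢v with v Fin.≟ centre u | u Fin.≟ centre v
          -- A pair of distinct vertices is a spoke in at most one direction: `centre` is
          -- idempotent, so u = centre v and v = centre u force u = v.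
          ... | yes v≡cu | yes u≡cv = contradiction
                  (≡.trans u≡cv (≡.trans (≡.cong centre v≡cu) (≡.trans (centre-c (g u)) (≡.sym v≡cu)))) u≢v
          ... | yes v≡cu | no _     = ℕ.≤-reflexive (≡.cong (ℕ._+ 1) (near-edge u≢v v≡cu))
          ... | no _     | yes u≡cv = ℕ.≤-reflexive (≡.cong (ℕ._+ 1)
                  (≡.trans (d-sym u v) (near-edge (u≢v ∘ ≡.sym) u≡cv)))
          ... | no _     | no _     = ≡.subst (ℕ._≤ 2) (≡.sym (ℕ.+-identityʳ (d u v))) (d≤2 u v)

          pointwise : ∀ u v → D u v * sq (x u - x v) + (spoke u v + spoke v u) ≤
            two * sq (x u) + (two * sq (x v) + ι (-[1+ 3 ]) * (x u * x v))
          pointwise u v with u Fin.≟ v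
          ... | yes ≡.refl = ≤-reflexive (solve 3 (λ D p x →
            D :* ((x :- x) :* (x :- x)) :+ (p :* ((x :- x) :* (x :- x)) :+ p :* ((x :- x) :* (x :- x))) :=
            con (+ 2) :* (x :* x) :+ (con (+ 2) :* (x :* x) :+ con (-[1+ 3 ]) :* (x :* x)))
            refl (D u u) (ι (+ p u u)) (x u))
          ... | no u≢v = ≤-by (nonneg-* (ι-mono (ℤ.+≤+ (d+p+p≤2 u≢v))) (nonneg-square (x u - x v))) (trans
            (*-congʳ (+-congˡ (-‿cong (trans (ι-+ (+ d u v) (+ (p u v ℕ.+ p v u))) (+-congˡ (ι-+ (+ p u v) (+ p v u)))))))
            (solve 5 (λ D p q x y → (con (+ 2) :- (D :+ (p :+ q))) :* ((x :- y) :* (x :- y)) :=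
              (con (+ 2) :* (x :* x) :+ (con (+ 2) :* (y :* y) :+ con (-[1+ 3 ]) :* (x :* y))) :-
              (D :* ((x :- y) :* (x :- y)) :+ (p :* ((x :- y) :* (x :- y)) :+ q :* ((y :- x) :* (y :- x)))))
              refl (D u v) (ι (+ p u v)) (ι (+ p v u)) (x u) (x v)))

          sum₂-spoke : sum₂ spoke ≈ spoke-energy
          sum₂-spoke = sum-cong λ u → trans
            (sum-single (spoke u) (centre u) λ v v≢cu → trans (*-congʳ (trans
              (reflexive (≡.cong (ι ∘ +_) (indicator-no (v Fin.≟ centre u) v≢cu))) ι-0)) (zeroˡ _))
            (trans (*-congʳ (trans (reflexive (≡.cong (ι ∘ +_) (indicator-yes (centre u Fin.≟ centre u) ≡.refl))) ι-1))
                   (*-identityˡ _))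

          sum₂-flip-spoke : sum₂ (flip spoke) ≈ spoke-energy
          sum₂-flip-spoke = trans (∑-comm (flip spoke)) sum₂-spoke

          total-bound : energy x + (spoke-energy + spoke-energy) ≤ ι (+ 4) * (N * σ)
          total-bound = ≤-resp
            (_⊕_ {f = λ u v → D u v * sq (x u - x v)} refl (_⊕_ {f = spoke} sum₂-spoke sum₂-flip-spoke))
            (trans (two ⊙ sum₂-squareˡ ⊕ two ⊙ sum₂-squareʳ ⊕ ι (-[1+ 3 ]) ⊙ sum₂-mixed)
              (trans (+-congˡ (+-congˡ (zeroʳ _)))
                (trans (+-congˡ (+-identityʳ _))
                  (solve 1 (λ t → con (+ 2) :* t :+ con (+ 2) :* t := con (+ 4) :* t)
                       refl (N * σ)))))
            (sum₂-mono pointwise)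

  module _ (1≤n : 1 ℕ.≤ n) {K : Fin n → Fin n → Carrier} (K≡M : K ≡ M)
    {r} (θ : Vector Carrier r) (distinct : ∀ i j → θ i ≈ θ j → i ≡ j)
    (β≤θ : ∀ i → β ≤ θ i) (θ≉β : ∀ i → ¬ θ i ≈ β)
    (m : Vector ℕ r) (b : ∀ i → Fin (m i) → Vector Carrier n)
    (eigen : ∀ i q → Eigenvector K (θ i) (b i q))
    (independent : ∀ i (c : Vector Carrier (m i)) → (∀ u → sum (λ q → c q * b i q u) ≈ 0#) → ∀ q → c q ≈ 0#)
    where

    energy-bound⇒⊥ : ∀ {j} (e : Fin j → Vector Carrier n) → j ℕ.< total m →
      ¬ (∀ x → sum x ≈ 0# → (∀ l → e l ∙ x ≈ 0#) → energy x ≤ two * (β * (x ∙ x)))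
    energy-bound⇒⊥ e j<m bound =
      eigenspaces-too-large M M-sym M-col-sum θ β β-nonneg distinct β≤θ θ≉β m b
        (≡.subst (λ K → ∀ i q → Eigenvector K (θ i) (b i q)) K≡M eigen) independent e j<m
        λ x x-sum ex≈0 → ≤-resp (energy-M x) refl (bound x x-sum ex≈0)
      where
      β-nonneg : Nonneg β
      β-nonneg = nonneg-resp (sym (ι-difference (+ (2 ℕ.* n)) 1ℤ))
        (ι-mono (ℤ.+≤+ (ℕ.≤-trans 1≤n (ℕ.m≤m+n n (n ℕ.+ 0)))))

    small-transmissions⇒no-eigenvectors : (∀ u v → u ≢ v → 1 ℕ.≤ d u v) →
      (∀ u → 2 ℕ.* transmissions u ℕ.+ 3 ℕ.≤ 3 ℕ.* n) → ¬ 0 ℕ.< total m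
    small-transmissions⇒no-eigenvectors d≥1 T-bound 0<m =
      energy-bound⇒⊥ (λ ()) 0<m λ x x-sum _ → small-transmission-bound x x-sum d≥1 T-bound

    stars⇒few-eigenvectors : ∀ {j} (c : Fin (suc j) → Fin n) (g : Fin n → Fin (suc j)) →
      (∀ i → c (g (c i)) ≡ c i) → (∀ u → u ≡ c (g u) ⊎ d u (c (g u)) ≡ 1) → (∀ u v → d u v ℕ.≤ 2) →
      ¬ suc j ℕ.≤ total m
    stars⇒few-eigenvectors c g cgc near d≤2 j<m =
      energy-bound⇒⊥ (starVector g ∘ suc) j<m λ x x-sum star-sums →
        star-bound x x-sum c g star-sums cgc near d≤2

  -- A single eigenvector enters the counting bound as one eigenvalue of multiplicity 1. Its linear
  -- independence follows from its being nonzero by stability and cancellation.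
  small-transmissions⇒no-eigenvalue : 1 ℕ.≤ n → ∀ {K} → K ≡ M → (∀ u v → u ≢ v → 1 ℕ.≤ d u v) →
    (∀ u → 2 ℕ.* transmissions u ℕ.+ 3 ℕ.≤ 3 ℕ.* n) →
    ∀ θ → β ≤ θ → ¬ θ ≈ β → ∀ y → Eigenvector K θ y → ¬ ¬ (∀ u → y u ≈ 0#)
  small-transmissions⇒no-eigenvalue 1≤n K≡M d≥1 T-bound θ β≤θ θ≉β y Ky≈θy y≉0 =
    small-transmissions⇒no-eigenvectors 1≤n K≡M {1} (λ _ → θ)
      (λ { zero zero _ → ≡.refl }) (λ _ → β≤θ) (λ _ → θ≉β) (λ _ → 1) (λ _ _ → y) (λ _ _ → Ky≈θy)
      (λ _ c cy≈0 → λ { zero → stable (c zero) λ c≉0 → y≉0 λ u →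
        cancelʳ (y u) (c zero) (trans (*-comm _ _) (trans (sym (+-identityʳ _)) (cy≈0 u))) c≉0 })
      d≥1 T-bound (ℕ.s≤s ℕ.z≤n)

open import Defs

-- Cauchy reals as an ordered domain

Eventually : (ℕ → Set) → Set
Eventually P = ∃[ N ] (∀ n → N ℕ.≤ n → P n)

eventually₂ : ∀ {P Q R : ℕ → Set} → (∀ n → P n → Q n → R n) → Eventually P → Eventually Q →
  Eventually R
eventually₂ f (N₁ , p) (N₂ , q) = N₁ ℕ.⊔ N₂ , λ n N≤n →
  f n (p n (ℕ.m⊔n≤o⇒m≤o N₁ N₂ N≤n)) (q n (ℕ.m⊔n≤o⇒n≤o N₁ N₂ N≤n))

Null : (ℕ → ℚ) → Set
Null s = ∀ ε → 0ℚ ℚ.< ε → Eventually λ n → ℚ.∣ s n ∣ ℚ.< ε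

Bounded : (ℕ → ℚ) → Set
Bounded s = ∃[ B ] (0ℚ ℚ.< B × Eventually λ n → ℚ.∣ s n ∣ ℚ.≤ B)

halve : ∀ ε → 0ℚ ℚ.< ε → 0ℚ ℚ.< ε ℚ.* ℚ.½
halve ε ε>0 = ≡.subst (ℚ._< ε ℚ.* ℚ.½) (ℚ.*-zeroˡ ℚ.½) (ℚ.*-monoˡ-<-pos ℚ.½ ε>0)

halves : ∀ ε → ε ℚ.* ℚ.½ ℚ.+ ε ℚ.* ℚ.½ ≡ ε
halves ε = ≡.trans (≡.sym (ℚ.*-distribˡ-+ ε ℚ.½ ℚ.½)) (ℚ.*-identityʳ ε)

0<1 : 0ℚ ℚ.< 1ℚ
0<1 = ℚ.positive⁻¹ 1ℚ

divide : ∀ ε B → 0ℚ ℚ.< ε → 0ℚ ℚ.< B → ∃[ δ ] (0ℚ ℚ.< δ × B ℚ.* δ ≡ ε)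
divide ε B ε>0 B>0 = ε ℚ.* B⁻¹ , δ>0 , (begin
    B ℚ.* (ε ℚ.* B⁻¹)  ≡⟨ solve 3 (λ b e i → b :* (e :* i) := (b :* i) :* e) ≡.refl B ε B⁻¹ ⟩
    (B ℚ.* B⁻¹) ℚ.* ε  ≡⟨ ≡.cong (ℚ._* ε) (ℚ.*-inverseʳ B) ⟩
    1ℚ ℚ.* ε           ≡⟨ ℚ.*-identityˡ ε ⟩
    ε                  ∎)
  where
  open ≡.≡-Reasoning
  open ℚ-Solver.+-*-Solver
  instance
    B-pos : ℚ.Positive B
    B-pos = ℚ.positive B>0
    B-nz : ℚ.NonZero B
    B-nz = ℚ.pos⇒nonZero B
  B⁻¹ : ℚ
  B⁻¹ = ℚ.1/ B
  instance
    B⁻¹-pos : ℚ.Positive B⁻¹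
    B⁻¹-pos = ℚ.1/pos⇒pos B
  δ>0 : 0ℚ ℚ.< ε ℚ.* B⁻¹
  δ>0 = ≡.subst (ℚ._< ε ℚ.* B⁻¹) (ℚ.*-zeroˡ B⁻¹) (ℚ.*-monoˡ-<-pos B⁻¹ ε>0)

∣p∣≤∣p-q∣+∣q∣ : ∀ p q → ℚ.∣ p ∣ ℚ.≤ ℚ.∣ p ℚ.- q ∣ ℚ.+ ℚ.∣ q ∣
∣p∣≤∣p-q∣+∣q∣ p q = ≡.subst (λ t → ℚ.∣ t ∣ ℚ.≤ ℚ.∣ p ℚ.- q ∣ ℚ.+ ℚ.∣ q ∣)
  (solve 2 (λ p q → (p :- q) :+ q := p) ≡.refl p q) (ℚ.∣p+q∣≤∣p∣+∣q∣ (p ℚ.- q) q)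
  where open ℚ-Solver.+-*-Solver

cauchy⇒bounded : ∀ x → Bounded (seq x)
cauchy⇒bounded x with cauchy x 1ℚ 0<1
... | N , close = 1ℚ ℚ.+ ℚ.∣ seq x N ∣ ,
  ℚ.+-mono-<-≤ 0<1 (ℚ.0≤∣p∣ (seq x N)) ,
  N , λ n N≤n → ℚ.≤-trans (∣p∣≤∣p-q∣+∣q∣ (seq x n) (seq x N))
                  (ℚ.+-monoˡ-≤ ℚ.∣ seq x N ∣ (ℚ.<⇒≤ (close n N N≤n ℕ.≤-refl)))

null-resp : ∀ {s t} → (∀ n → s n ≡ t n) → Null s → Null t
null-resp s≡t null-s ε ε>0 with null-s ε ε>0
... | N , small = N , λ n N≤n → ≡.subst (λ q → ℚ.∣ q ∣ ℚ.< ε) (s≡t n) (small n N≤n)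

null-zero : ∀ {s} → (∀ n → s n ≡ 0ℚ) → Null s
null-zero s≡0 ε ε>0 = 0 , λ n _ → ≡.subst (λ q → ℚ.∣ q ∣ ℚ.< ε) (≡.sym (s≡0 n)) ε>0

null-+ : ∀ {s t} → Null s → Null t → Null (λ n → s n ℚ.+ t n)
null-+ {s} {t} null-s null-t ε ε>0 = eventually₂
  (λ n s< t< → ≡.subst (ℚ.∣ s n ℚ.+ t n ∣ ℚ.<_) (halves ε)
    (ℚ.≤-<-trans (ℚ.∣p+q∣≤∣p∣+∣q∣ (s n) (t n)) (ℚ.+-mono-< s< t<)))
  (null-s _ (halve ε ε>0)) (null-t _ (halve ε ε>0))

null-* : ∀ {s t} → Bounded s → Null t → Null (λ n → s n ℚ.* t n)
null-* {s} {t} (B , B>0 , s≤B) null-t ε ε>0 =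
  let δ , δ>0 , Bδ≡ε = divide ε B ε>0 B>0 in eventually₂
  (λ n s≤ t< → begin-strict
    ℚ.∣ s n ℚ.* t n ∣         ≡⟨ ℚ.∣p*q∣≡∣p∣*∣q∣ (s n) (t n) ⟩
    ℚ.∣ s n ∣ ℚ.* ℚ.∣ t n ∣   ≤⟨ ℚ.*-monoʳ-≤-nonNeg ℚ.∣ t n ∣ {{ℚ.∣-∣-nonNeg (t n)}} s≤ ⟩
    B ℚ.* ℚ.∣ t n ∣           <⟨ ℚ.*-monoʳ-<-pos B {{ℚ.positive B>0}} t< ⟩
    B ℚ.* δ                   ≡⟨ Bδ≡ε ⟩
    ε                         ∎)
  s≤B (null-t δ δ>0)
  where open ℚ.≤-Reasoning

AwayFromZero : (ℕ → ℚ) → Set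
AwayFromZero s = ∃[ η ] (0ℚ ℚ.< η × Eventually λ n → η ℚ.≤ ℚ.∣ s n ∣)

-- For a fixed tolerance the choice is decidable: one rational term, taken where the sequence varies
-- by less than ε/4, is compared with ε/2. If it is smaller, all later terms stay below ε; otherwise
-- they stay at least ε/4 away from zero.
small-or-away : ∀ x ε → 0ℚ ℚ.< ε → (Eventually λ n → ℚ.∣ seq x n ∣ ℚ.< ε) ⊎ AwayFromZero (seq x)
small-or-away x ε ε>0 = decide (ℚ.∣ seq x N ∣ ℚ.<? η)
  where
  open ℚ.≤-Reasoning
  η κ : ℚ
  η = ε ℚ.* ℚ.½
  κ = η ℚ.* ℚ.½

  κ>0 : 0ℚ ℚ.< κ
  κ>0 = halve η (halve ε ε>0)

  κ<η : κ ℚ.< η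
  κ<η = ≡.subst₂ ℚ._<_ (ℚ.+-identityˡ κ) (halves η) (ℚ.+-mono-<-≤ κ>0 ℚ.≤-refl)

  N : ℕ
  N = proj₁ (cauchy x κ κ>0)

  close : ∀ m n → N ℕ.≤ m → N ℕ.≤ n → ℚ.∣ seq x m ℚ.- seq x n ∣ ℚ.< κ
  close = proj₂ (cauchy x κ κ>0)

  decide : Dec (ℚ.∣ seq x N ∣ ℚ.< η) → _
  decide (yes xN<η) = inj₁ (N , λ n N≤n → begin-strict
    ℚ.∣ seq x n ∣                                 ≤⟨ ∣p∣≤∣p-q∣+∣q∣ (seq x n) (seq x N) ⟩
    ℚ.∣ seq x n ℚ.- seq x N ∣ ℚ.+ ℚ.∣ seq x N ∣   <⟨ ℚ.+-mono-< (ℚ.<-trans (close n N N≤n ℕ.≤-refl) κ<η) xN<η ⟩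
    η ℚ.+ η                                       ≡⟨ halves ε ⟩
    ε                                             ∎)
  decide (no xN≮η) = inj₂ (κ , κ>0 , N , λ n N≤n → ℚ.≮⇒≥ λ xn<κ → xN≮η (begin-strict
    ℚ.∣ seq x N ∣                                 ≤⟨ ∣p∣≤∣p-q∣+∣q∣ (seq x N) (seq x n) ⟩
    ℚ.∣ seq x N ℚ.- seq x n ∣ ℚ.+ ℚ.∣ seq x n ∣   <⟨ ℚ.+-mono-< (close N n ℕ.≤-refl N≤n) xn<κ ⟩
    κ ℚ.+ κ                                       ≡⟨ halves η ⟩
    η                                             ∎))

away⇒¬null : ∀ {s} → AwayFromZero s → ¬ Null s
away⇒¬null (η , η>0 , N₁ , away) null with null η η>0
... | N₂ , small = ℚ.<-irrefl ≡.refl (ℚ.<-≤-trans (small _ (ℕ.m≤n⊔m N₁ N₂)) (away _ (ℕ.m≤m⊔n N₁ N₂)))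

null-stable : ∀ x → ¬ ¬ Null (seq x) → Null (seq x)
null-stable x ¬¬null ε ε>0 with small-or-away x ε ε>0
... | inj₁ small = small
... | inj₂ away  = contradiction (away⇒¬null away) ¬¬null

null-cancel : ∀ {s t} → Null (λ n → s n ℚ.* t n) → AwayFromZero s → Null t
null-cancel {s} {t} null-st (η , η>0 , away) ε ε>0 = eventually₂
  (λ n st< η≤s → ℚ.≰⇒> λ ε≤t → ℚ.<-irrefl ≡.refl (ℚ.<-≤-trans st< (begin
    η ℚ.* ε                   ≤⟨ ℚ.*-monoˡ-≤-nonNeg η {{ℚ.pos⇒nonNeg η {{ℚ.positive η>0}}}} ε≤t ⟩
    η ℚ.* ℚ.∣ t n ∣           ≤⟨ ℚ.*-monoʳ-≤-nonNeg ℚ.∣ t n ∣ {{ℚ.∣-∣-nonNeg (t n)}} η≤s ⟩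
    ℚ.∣ s n ∣ ℚ.* ℚ.∣ t n ∣   ≡⟨ ℚ.∣p*q∣≡∣p∣*∣q∣ (s n) (t n) ⟨
    ℚ.∣ s n ℚ.* t n ∣         ∎)))
  (null-st (η ℚ.* ε) (≡.subst (ℚ._< η ℚ.* ε) (ℚ.*-zeroʳ η) (ℚ.*-monoʳ-<-pos η {{ℚ.positive η>0}} ε>0))) away
  where open ℚ.≤-Reasoning

-- Negation as a product with -1 inherits its Cauchy proof from `_*ℝ_`.
-ℝ_ : ℝ → ℝ
-ℝ x = fromℚ (ℚ.- 1ℚ) *ℝ x

pointwise : ∀ {x y} → (∀ n → seq x n ≡ seq y n) → x ≈ y
pointwise {x} {y} x≡y = null-zero λ n → ≡.trans (≡.cong (ℚ._- seq y n) (x≡y n)) (ℚ.+-inverseʳ (seq y n))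

module _ where
  open ℚ-Solver.+-*-Solver

  ≈-sym : ∀ {x y} → x ≈ y → y ≈ x
  ≈-sym {x} {y} x≈y = null-resp
    (λ n → solve 2 (λ x y → con (ℚ.- 1ℚ) :* (x :- y) := y :- x) ≡.refl (seq x n) (seq y n))
    (null-* (cauchy⇒bounded (fromℚ (ℚ.- 1ℚ))) x≈y)

  ≈-trans : ∀ {x y z} → x ≈ y → y ≈ z → x ≈ z
  ≈-trans {x} {y} {z} x≈y y≈z = null-resp
    (λ n → solve 3 (λ x y z → (x :- y) :+ (y :- z) := x :- z) ≡.refl (seq x n) (seq y n) (seq z n))
    (null-+ x≈y y≈z)

  +ℝ-cong : ∀ {x y u v} → x ≈ y → u ≈ v → x +ℝ u ≈ y +ℝ v
  +ℝ-cong {x} {y} {u} {v} x≈y u≈v = null-resp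
    (λ n → solve 4 (λ x y u v → (x :- y) :+ (u :- v) := (x :+ u) :- (y :+ v))
         ≡.refl (seq x n) (seq y n) (seq u n) (seq v n))
    (null-+ x≈y u≈v)

  *ℝ-cong : ∀ {x y u v} → x ≈ y → u ≈ v → x *ℝ u ≈ y *ℝ v
  *ℝ-cong {x} {y} {u} {v} x≈y u≈v = null-resp
    (λ n → solve 4 (λ x y u v → u :* (x :- y) :+ y :* (u :- v) := x :* u :- y :* v)
         ≡.refl (seq x n) (seq y n) (seq u n) (seq v n))
    (null-+ (null-* (cauchy⇒bounded u) x≈y) (null-* (cauchy⇒bounded y) u≈v))

  ℝ-ring : CommutativeRing 0ℓ 0ℓ
  ℝ-ring = record
    { Carrier = ℝ ; _≈_ = _≈_ ; _+_ = _+ℝ_ ; _*_ = _*ℝ_ ; -_ = -ℝ_ ; 0# = 0ℝ ; 1# = fromℤ 1ℤ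
    ; isCommutativeRing = record
      { isRing = record
        { +-isAbelianGroup = record
          { isGroup = record
            { isMonoid = record
              { isSemigroup = record
                { isMagma = record
                  { isEquivalence = record
                    { refl  = λ {x} → pointwise {x} {x} λ _ → ≡.refl
                    ; sym   = λ {x} {y} → ≈-sym {x} {y}
                    ; trans = λ {x} {y} {z} → ≈-trans {x} {y} {z}
                    }
                  ; ∙-cong = λ {x} {y} {u} {v} → +ℝ-cong {x} {y} {u} {v}
                  }
                ; assoc = λ x y z → pointwise {x +ℝ y +ℝ z} {x +ℝ (y +ℝ z)} λ n → ℚ.+-assoc (seq x n) (seq y n) (seq z n)
                }
              ; identity = (λ x → pointwise {0ℝ +ℝ x} {x} λ n → ℚ.+-identityˡ (seq x n)) ,
                           (λ x → pointwise {x +ℝ 0ℝ} {x} λ n → ℚ.+-identityʳ (seq x n))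
              }
            ; inverse = (λ x → pointwise {(-ℝ x) +ℝ x} {0ℝ} λ n →
                          solve 1 (λ x → con (ℚ.- 1ℚ) :* x :+ x := con 0ℚ) ≡.refl (seq x n)) ,
                        (λ x → pointwise {x +ℝ (-ℝ x)} {0ℝ} λ n →
                          solve 1 (λ x → x :+ con (ℚ.- 1ℚ) :* x := con 0ℚ) ≡.refl (seq x n))
            ; ⁻¹-cong = λ {x} {y} → *ℝ-cong {fromℚ (ℚ.- 1ℚ)} {fromℚ (ℚ.- 1ℚ)} {x} {y}
                          (pointwise {fromℚ (ℚ.- 1ℚ)} {fromℚ (ℚ.- 1ℚ)} λ _ → ≡.refl)
            }
          ; comm = λ x y → pointwise {x +ℝ y} {y +ℝ x} λ n → ℚ.+-comm (seq x n) (seq y n)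
          }
        ; *-cong = λ {x} {y} {u} {v} → *ℝ-cong {x} {y} {u} {v}
        ; *-assoc = λ x y z → pointwise {x *ℝ y *ℝ z} {x *ℝ (y *ℝ z)} λ n → ℚ.*-assoc (seq x n) (seq y n) (seq z n)
        ; *-identity = (λ x → pointwise {fromℤ 1ℤ *ℝ x} {x} λ n → ℚ.*-identityˡ (seq x n)) ,
                       (λ x → pointwise {x *ℝ fromℤ 1ℤ} {x} λ n → ℚ.*-identityʳ (seq x n))
        ; distrib = (λ x y z → pointwise {x *ℝ (y +ℝ z)} {x *ℝ y +ℝ x *ℝ z} λ n → ℚ.*-distribˡ-+ (seq x n) (seq y n) (seq z n)) ,
                    (λ x y z → pointwise {(y +ℝ z) *ℝ x} {y *ℝ x +ℝ z *ℝ x} λ n → ℚ.*-distribʳ-+ (seq x n) (seq y n) (seq z n))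
        }
      ; *-comm = λ x y → pointwise {x *ℝ y} {y *ℝ x} λ n → ℚ.*-comm (seq x n) (seq y n)
      }
    }

-- Division in ℚ normalises by a gcd that does not reduce for a variable numerator, so the identity
-- is checked on unnormalised fractions.
/1-homo-+ : ∀ a b → (a ℤ.+ b) ℚ./ 1 ≡ a ℚ./ 1 ℚ.+ b ℚ./ 1
/1-homo-+ a b = ℚ.toℚᵘ-injective (begin
  ℚ.toℚᵘ ((a ℤ.+ b) ℚ./ 1)                ≈⟨ ℚ.toℚᵘ-fromℚᵘ (ℚᵘ.mkℚᵘ (a ℤ.+ b) 0) ⟩
  ℚᵘ.mkℚᵘ (a ℤ.+ b) 0                     ≈⟨ ℚᵘ.*≡* (≡.cong (ℤ._* 1ℤ) (≡.sym (≡.cong₂ ℤ._+_ (ℤ.*-identityʳ a) (ℤ.*-identityʳ b)))) ⟩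
  ℚᵘ.mkℚᵘ a 0 ℚᵘ.+ ℚᵘ.mkℚᵘ b 0            ≈⟨ ℚᵘ.+-cong (ℚ.toℚᵘ-fromℚᵘ (ℚᵘ.mkℚᵘ a 0)) (ℚ.toℚᵘ-fromℚᵘ (ℚᵘ.mkℚᵘ b 0)) ⟨
  ℚ.toℚᵘ (a ℚ./ 1) ℚᵘ.+ ℚ.toℚᵘ (b ℚ./ 1)  ≈⟨ ℚ.toℚᵘ-homo-+ (a ℚ./ 1) (b ℚ./ 1) ⟨
  ℚ.toℚᵘ (a ℚ./ 1 ℚ.+ b ℚ./ 1)            ∎)
  where open ℚᵘ.≃-Reasoning

/1-homo-* : ∀ a b → (a ℤ.* b) ℚ./ 1 ≡ (a ℚ./ 1) ℚ.* (b ℚ./ 1)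
/1-homo-* a b = ℚ.toℚᵘ-injective (begin
  ℚ.toℚᵘ ((a ℤ.* b) ℚ./ 1)                ≈⟨ ℚ.toℚᵘ-fromℚᵘ (ℚᵘ.mkℚᵘ (a ℤ.* b) 0) ⟩
  ℚᵘ.mkℚᵘ a 0 ℚᵘ.* ℚᵘ.mkℚᵘ b 0            ≈⟨ ℚᵘ.*-cong (ℚ.toℚᵘ-fromℚᵘ (ℚᵘ.mkℚᵘ a 0)) (ℚ.toℚᵘ-fromℚᵘ (ℚᵘ.mkℚᵘ b 0)) ⟨
  ℚ.toℚᵘ (a ℚ./ 1) ℚᵘ.* ℚ.toℚᵘ (b ℚ./ 1)  ≈⟨ ℚ.toℚᵘ-homo-* (a ℚ./ 1) (b ℚ./ 1) ⟨
  ℚ.toℚᵘ ((a ℚ./ 1) ℚ.* (b ℚ./ 1))        ∎)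
  where open ℚᵘ.≃-Reasoning

/1-homo-neg : ∀ a → (ℤ.- a) ℚ./ 1 ≡ (ℚ.- 1ℚ) ℚ.* (a ℚ./ 1)
/1-homo-neg a = ≡.trans (≡.cong (ℚ._/ 1) (≡.sym (ℤ.-1*i≡-i a))) (/1-homo-* (ℤ.- 1ℤ) a)

-- Nonnegativity through an equal real with nonnegative approximations, so that
-- closure under sums and products holds pointwise.
NonnegativeRepresentative : ℝ → Set
NonnegativeRepresentative x = ∃[ y ] (x ≈ y × (∀ n → 0ℚ ℚ.≤ seq y n))

ℝ-orderedDomain : OrderedDomain
ℝ-orderedDomain = record
  { ring = ℝ-ring
  ; fromInteger = record
    { ⟦_⟧    = fromℤ
    ; +-homo = λ a b → pointwise {fromℤ (a ℤ.+ b)} {fromℤ a +ℝ fromℤ b} λ _ → /1-homo-+ a b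
    ; *-homo = λ a b → pointwise {fromℤ (a ℤ.* b)} {fromℤ a *ℝ fromℤ b} λ _ → /1-homo-* a b
    ; -‿homo = λ a → pointwise {fromℤ (ℤ.- a)} { -ℝ fromℤ a} λ _ → /1-homo-neg a
    ; 0-homo = R.refl {0ℝ}
    ; 1-homo = R.refl {fromℤ 1ℤ}
    }
  ; 1≉0 = away⇒¬null {λ _ → 1ℚ} (1ℚ , 0<1 , 0 , λ _ _ → ℚ.≤-refl {1ℚ})
  ; stable = λ x ¬¬x≈0 → null⇒≈0 x (null-stable x λ ¬null → ¬¬x≈0 (¬null ∘ ≈0⇒null x))
  -- The dichotomy is applied to x for each tolerance separately: were x away from zero, y would be
  -- null, against the assumption.
  ; cancelʳ = λ x y xy≈0 y≉0 → null⇒≈0 x λ ε ε>0 → [ (λ small → small) ,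
      (λ away → contradiction (null⇒≈0 y (null-cancel (≈0⇒null (x *ℝ y) xy≈0) away)) y≉0) ]
      (small-or-away x ε ε>0)
  ; Nonneg = NonnegativeRepresentative
  ; nonneg-resp = λ {x} {y} x≈y (x′ , x≈x′ , x′≥0) →
      x′ , R.trans {y} {x} {x′} (R.sym {x} {y} x≈y) x≈x′ , x′≥0
  ; nonneg-+ = λ {x} {y} (x′ , x≈x′ , x′≥0) (y′ , y≈y′ , y′≥0) →
      x′ +ℝ y′ , R.+-cong {x} {x′} {y} {y′} x≈x′ y≈y′ , λ n → ℚ.+-mono-≤ (x′≥0 n) (y′≥0 n)
  ; nonneg-* = λ {x} {y} (x′ , x≈x′ , x′≥0) (y′ , y≈y′ , y′≥0) →
      x′ *ℝ y′ , R.*-cong {x} {x′} {y} {y′} x≈x′ y≈y′ , λ n → *-nonneg (x′≥0 n) (y′≥0 n)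
  ; nonneg-square = λ x → x *ℝ x , R.refl {x *ℝ x} , λ n → square-nonneg (seq x n)
  ; nonneg-ι = λ k → fromℤ (+ k) , R.refl {fromℤ (+ k)} , λ _ → ℚ.nonNegative⁻¹ (+ k ℚ./ 1) {{ℚ.normalize-nonNeg k 1}}
  ; nonneg-antisym = antisym
  }
  where
  module R = CommutativeRing ℝ-ring
  ≈0⇒null : ∀ x → x ≈ 0ℝ → Null (seq x)
  ≈0⇒null x = null-resp λ n → ℚ.+-identityʳ (seq x n)

  null⇒≈0 : ∀ x → Null (seq x) → x ≈ 0ℝ
  null⇒≈0 x = null-resp λ n → ≡.sym (ℚ.+-identityʳ (seq x n))

  *-nonneg : ∀ {p q} → 0ℚ ℚ.≤ p → 0ℚ ℚ.≤ q → 0ℚ ℚ.≤ p ℚ.* q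
  *-nonneg {p} {q} p≥0 q≥0 = ℚ.≤-trans (ℚ.≤-reflexive (≡.sym (ℚ.*-zeroʳ p)))
    (ℚ.*-monoˡ-≤-nonNeg p {{ℚ.nonNegative p≥0}} q≥0)

  square-nonneg : ∀ p → 0ℚ ℚ.≤ p ℚ.* p
  square-nonneg p with ℚ.∣p∣≡p∨∣p∣≡-p p
  ... | inj₁ e = *-nonneg p≥0 p≥0
    where p≥0 = ≡.subst (0ℚ ℚ.≤_) e (ℚ.0≤∣p∣ p)
  ... | inj₂ e = ≡.subst (0ℚ ℚ.≤_) (solve 1 (λ p → (:- p) :* (:- p) := p :* p)
       ≡.refl p) (*-nonneg -p≥0 -p≥0)
    where
    open ℚ-Solver.+-*-Solver
    -p≥0 = ≡.subst (0ℚ ℚ.≤_) e (ℚ.0≤∣p∣ p)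

  antisym : ∀ x → NonnegativeRepresentative x → NonnegativeRepresentative (-ℝ x) → x ≈ 0ℝ
  antisym x (y , x≈y , y≥0) (z , -x≈z , z≥0) = R.trans {x} {y} {0ℝ} x≈y (null⇒≈0 y y-null)
    where
    y+z≈0 : y +ℝ z ≈ 0ℝ
    y+z≈0 = R.trans {y +ℝ z} {x +ℝ (-ℝ x)} {0ℝ}
      (R.sym {x +ℝ (-ℝ x)} {y +ℝ z} (R.+-cong {x} {y} { -ℝ x} {z} x≈y -x≈z)) (R.-‿inverseʳ x)

    y-null : Null (seq y)
    y-null ε ε>0 = proj₁ sum-small , λ n N≤n → begin-strict
      ℚ.∣ seq y n ∣               ≡⟨ ℚ.0≤p⇒∣p∣≡p (y≥0 n) ⟩
      seq y n                     ≡⟨ ℚ.+-identityʳ (seq y n) ⟨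
      seq y n ℚ.+ 0ℚ              ≤⟨ ℚ.+-monoʳ-≤ (seq y n) (z≥0 n) ⟩
      seq y n ℚ.+ seq z n         ≡⟨ ℚ.0≤p⇒∣p∣≡p (ℚ.+-mono-≤ (y≥0 n) (z≥0 n)) ⟨
      ℚ.∣ seq y n ℚ.+ seq z n ∣   <⟨ proj₂ sum-small n N≤n ⟩
      ε                           ∎
      where
      open ℚ.≤-Reasoning
      sum-small : Eventually λ n → ℚ.∣ seq y n ℚ.+ seq z n ∣ ℚ.< ε
      sum-small = ≈0⇒null (y +ℝ z) y+z≈0 ε ε>0

-- The gap is guaranteed only from index N on. Dropping the first N terms does not change the real
-- number and makes every remaining term positive.
<ℝ⇒nonneg : ∀ x y → x <ℝ y → NonnegativeRepresentative (y +ℝ (-ℝ x))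
<ℝ⇒nonneg x y (ε , ε>0 , N , gap) = shifted , shift-close , λ n → ℚ.<⇒≤ (positive n)
  where
  z : ℝ
  z = y +ℝ (-ℝ x)

  shifted : ℝ
  seq    shifted n = seq z (N ℕ.+ n)
  cauchy shifted ε ε>0 with cauchy z ε ε>0
  ... | M , close = M , λ m n M≤m M≤n → close (N ℕ.+ m) (N ℕ.+ n) (ℕ.m≤n⇒m≤o+n N M≤m) (ℕ.m≤n⇒m≤o+n N M≤n)

  shift-close : z ≈ shifted
  shift-close ε ε>0 with cauchy z ε ε>0
  ... | M , close = M , λ n M≤n → close n (N ℕ.+ n) M≤n (ℕ.m≤n⇒m≤o+n N M≤n)

  positive : ∀ n → 0ℚ ℚ.< seq shifted n
  positive n = begin-strict
    0ℚ                                                       <⟨ ε>0 ⟩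
    ε                                                        ≡⟨ solve 2 (λ a e → e :=
         (a :+ e) :+ con (ℚ.- 1ℚ) :* a)
         ≡.refl (seq x (N ℕ.+ n)) ε ⟩
    seq x (N ℕ.+ n) ℚ.+ ε ℚ.+ (ℚ.- 1ℚ) ℚ.* seq x (N ℕ.+ n)  <⟨ ℚ.+-monoˡ-< _ (gap (N ℕ.+ n) (ℕ.m≤m+n N n)) ⟩
    seq y (N ℕ.+ n) ℚ.+ (ℚ.- 1ℚ) ℚ.* seq x (N ℕ.+ n)        ∎
    where
    open ℚ.≤-Reasoning
    open ℚ-Solver.+-*-Solver

<ℝ⇒≉ : ∀ x y → x <ℝ y → ¬ y ≈ x
<ℝ⇒≉ x y (ε , ε>0 , N₁ , gap) y≈x with y≈x ε ε>0
... | N₂ , close = ℚ.<-irrefl ≡.refl (begin-strict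
    seq x n ℚ.+ ε                      <⟨ gap n (ℕ.m≤m⊔n N₁ N₂) ⟩
    seq y n                            ≡⟨ solve 2 (λ x y → y := x :+ (y :- x))
         ≡.refl (seq x n) (seq y n) ⟩
    seq x n ℚ.+ (seq y n ℚ.- seq x n)  ≤⟨ ℚ.+-monoʳ-≤ (seq x n) (p≤∣p∣ (seq y n ℚ.- seq x n)) ⟩
    seq x n ℚ.+ ℚ.∣ seq y n ℚ.- seq x n ∣  <⟨ ℚ.+-monoʳ-< (seq x n) (close n (ℕ.m≤n⊔m N₁ N₂)) ⟩
    seq x n ℚ.+ ε                      ∎)
  where
  open ℚ.≤-Reasoning
  open ℚ-Solver.+-*-Solver
  n = N₁ ℕ.⊔ N₂
  p≤∣p∣ : ∀ p → p ℚ.≤ ℚ.∣ p ∣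
  p≤∣p∣ p with ℚ.≤-total 0ℚ p
  ... | inj₁ 0≤p = ℚ.≤-reflexive (≡.sym (ℚ.0≤p⇒∣p∣≡p 0≤p))
  ... | inj₂ p≤0 = ℚ.≤-trans p≤0 (ℚ.0≤∣p∣ p)

-- Graphs of diameter at most 2: degrees, transmissions and stars

≤-foldr-⊔ : ∀ {k} (f : Vector ℕ k) i → f i ℕ.≤ Vector.foldr ℕ._⊔_ 0 f
≤-foldr-⊔ f zero    = ℕ.m≤m⊔n (f zero) _
≤-foldr-⊔ f (suc i) = ℕ.≤-trans (≤-foldr-⊔ (f ∘ suc) i) (ℕ.m≤n⊔m (f zero) _)

length-filter-tabulate : ∀ {A : Set} {P : A → Set} (P? : ∀ x → Dec (P x)) {k} (f : Fin k → A) →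
  List.length (List.filter P? (List.tabulate f)) ≡ total (indicator ∘ P? ∘ f)
length-filter-tabulate P? {zero}  f = ≡.refl
length-filter-tabulate P? {suc k} f with P? (f zero)
... | yes _ = ≡.cong suc (length-filter-tabulate P? (f ∘ suc))
... | no _  = length-filter-tabulate P? (f ∘ suc)

module DiameterTwo {n} (G : Graph (Fin n)) (connected : Connected G) (diam≤2 : diameter G connected ℕ.≤ 2) where
  open Graph G

  d : Fin n → Fin n → ℕ
  d = distance G connected

  shortest : ∀ {u v ℓ} → PathOfLength G u v ℓ → d u v ℕ.≤ ℓ
  shortest {u} {v} {ℓ} = proj₂ (proj₂ (distance-spec G connected u v)) ℓ

  walk : ∀ {u v k} → d u v ≡ k → Σ[ p ∈ Walk G u v ] length p ≡ k
  walk {u} {v} d≡k with proj₁ (proj₂ (distance-spec G connected u v))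
  ... | p , _ , length≡d = p , ≡.trans length≡d d≡k

  d≤2 : ∀ u v → d u v ℕ.≤ 2
  d≤2 u v = ℕ.≤-trans (≤-foldr-⊔ (d u) v)
    (ℕ.≤-trans (≤-foldr-⊔ (λ u → Vector.foldr ℕ._⊔_ 0 (d u)) u) diam≤2)

  d-refl : ∀ u → d u u ≡ 0
  d-refl u = ℕ.n≤0⇒n≡0 (shortest (stop u , [] ∷ [] , ≡.refl))

  d≡0⇒≡ : ∀ {u v} → d u v ≡ 0 → u ≡ v
  d≡0⇒≡ d≡0 with walk d≡0
  ... | stop _ , _ = ≡.refl

  ~⇒d≡1 : ∀ {u v} → u ~ v → d u v ≡ 1
  ~⇒d≡1 {u} {v} u~v = ℕ.≤-antisym
    (shortest (step u u~v (stop v) , (u≢v ∷ []) ∷ [] ∷ [] , ≡.refl))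
    (ℕ.n≢0⇒n>0 (u≢v ∘ d≡0⇒≡))
    where
    u≢v : u ≢ v
    u≢v ≡.refl = ~-irrefl u~v

  d≡1⇒~ : ∀ {u v} → d u v ≡ 1 → u ~ v
  d≡1⇒~ d≡1 with walk d≡1
  ... | step _ u~v (stop _) , _ = u~v

  data Position (u v : Fin n) : Set where
    equal    : u ≡ v → d u v ≡ 0 → Position u v
    adjacent : u ~ v → d u v ≡ 1 → Position u v
    distant  : ∀ w → u ~ w → w ~ v → d u v ≡ 2 → Position u v

  position : ∀ u v → Position u v
  position u v with d u v in d≡ | d≤2 u v
  ... | 0 | _ = equal (d≡0⇒≡ d≡) d≡
  ... | 1 | _ = adjacent (d≡1⇒~ d≡) d≡
  ... | 2 | _ with walk d≡
  ...   | step _ u~w (step _ w~v (stop _)) , _ = distant _ u~w w~v d≡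
  position u v | suc (suc (suc _)) | ℕ.s≤s (ℕ.s≤s ())

  d-sym : ∀ u v → d u v ≡ d v u
  d-sym u v with position u v | position v u
  ... | equal ≡.refl _   | _                  = ≡.refl
  ... | adjacent u~v d≡1 | _                  = ≡.trans d≡1 (≡.sym (~⇒d≡1 (~-sym u~v)))
  ... | distant _ _ _ _  | equal ≡.refl _     = ≡.refl
  ... | distant _ _ _ _  | adjacent v~u d≡1   = ≡.trans (~⇒d≡1 (~-sym v~u)) (≡.sym d≡1)
  ... | distant _ _ _ d≡2 | distant _ _ _ d≡2′ = ≡.trans d≡2 (≡.sym d≡2′)

  d≥1 : ∀ u v → u ≢ v → 1 ℕ.≤ d u v
  d≥1 u v u≢v = ℕ.n≢0⇒n>0 (u≢v ∘ d≡0⇒≡)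

  neighbour-of : ∀ v {u} → v ≢ u → ∃[ w ] v ~ w
  neighbour-of v {u} v≢u with position v u
  ... | equal v≡u _       = contradiction v≡u v≢u
  ... | adjacent v~u _    = u , v~u
  ... | distant w v~w _ _ = w , v~w

  neighbours : Fin n → List.List (Fin n)
  neighbours v = List.filter (v ~?_) (List.allFin n)

  degree : Fin n → ℕ
  degree v = List.length (neighbours v)

  neighbour : ∀ v → Fin (degree v) → Fin n
  neighbour v = List.lookup (neighbours v)

  neighbour-~ : ∀ v i → v ~ neighbour v i
  neighbour-~ v i = proj₂ (∈-filter⁻ (v ~?_) {xs = List.allFin n} (∈-lookup {xs = neighbours v} i))

  ~⇒neighbour : ∀ {v u} → v ~ u → ∃[ i ] neighbour v i ≡ u
  ~⇒neighbour {v} {u} v~u = index u∈N , ≡.sym (Any.lookup-index u∈N)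
    where u∈N = ∈-filter⁺ (v ~?_) (∈-allFin u) v~u

  -- Every vertex u contributes exactly 2: by distance 2, by distance 1 plus adjacency, or by the
  -- extra 2 for u = v. The additive form avoids truncated subtraction.
  transmission-degree : ∀ v → degree v ℕ.+ (total (λ u → d u v) ℕ.+ 2) ≡ n ℕ.* 2
  transmission-degree v = begin
    degree v ℕ.+ (T ℕ.+ 2)
      ≡⟨ ≡.cong₂ ℕ._+_ (length-filter-tabulate (v ~?_) (λ u → u)) (≡.cong (T ℕ.+_) (≡.sym single)) ⟩
    total (λ u → indicator (v ~? u)) ℕ.+ (T ℕ.+ total (λ u → 2 ℕ.* indicator (u Fin.≟ v)))
      ≡⟨ ≡.cong (total (λ u → indicator (v ~? u)) ℕ.+_) (∑-distrib-+ (λ u → d u v) (λ u → 2 ℕ.* indicator (u Fin.≟ v))) ⟨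
    total (λ u → indicator (v ~? u)) ℕ.+ total (λ u → d u v ℕ.+ 2 ℕ.* indicator (u Fin.≟ v))
      ≡⟨ ∑-distrib-+ (λ u → indicator (v ~? u)) (λ u → d u v ℕ.+ 2 ℕ.* indicator (u Fin.≟ v)) ⟨
    total (λ u → indicator (v ~? u) ℕ.+ (d u v ℕ.+ 2 ℕ.* indicator (u Fin.≟ v)))
      ≡⟨ sum-cong-≋ summand ⟩
    total {n} (λ _ → 2)
      ≡⟨ total-const n 2 ⟩
    n ℕ.* 2 ∎
    where
    open ≡.≡-Reasoning
    open SemiringSum ℕ.+-*-semiring using (∑-distrib-+; sum-cong-≋; sum-remove)

    T : ℕ
    T = total λ u → d u v

    total-const : ∀ k c → total {k} (λ _ → c) ≡ k ℕ.* c
    total-const zero    c = ≡.refl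
    total-const (suc k) c = ≡.cong (c ℕ.+_) (total-const k c)

    total-zero : ∀ {k} (f : Vector ℕ k) → (∀ i → f i ≡ 0) → total f ≡ 0
    total-zero {k} f f≡0 = ≡.trans (sum-cong-≋ f≡0) (≡.trans (total-const k 0) (ℕ.*-zeroʳ k))

    total-single : ∀ {k} (f : Vector ℕ k) i → (∀ j → j ≢ i → f j ≡ 0) → total f ≡ f i
    total-single {suc k} f i f≡0 = ≡.trans (sum-remove {i = i} f)
      (≡.trans (≡.cong (f i ℕ.+_) (total-zero _ λ j → f≡0 _ (Fin.punchInᵢ≢i i j))) (ℕ.+-identityʳ (f i)))

    single : total (λ u → 2 ℕ.* indicator (u Fin.≟ v)) ≡ 2
    single = ≡.trans (total-single _ v λ u u≢v → ≡.cong (2 ℕ.*_) (indicator-no (u Fin.≟ v) u≢v))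
                     (≡.cong (2 ℕ.*_) (indicator-yes (v Fin.≟ v) ≡.refl))

    summand : ∀ u → indicator (v ~? u) ℕ.+ (d u v ℕ.+ 2 ℕ.* indicator (u Fin.≟ v)) ≡ 2
    summand u with position u v
    ... | equal ≡.refl d≡0 = ≡.cong₂ ℕ._+_ (indicator-no (u ~? u) ~-irrefl)
            (≡.cong₂ ℕ._+_ d≡0 (≡.cong (2 ℕ.*_) (indicator-yes (u Fin.≟ u) ≡.refl)))
    ... | adjacent u~v d≡1 = ≡.cong₂ ℕ._+_ (indicator-yes (v ~? u) (~-sym u~v))
            (≡.cong₂ ℕ._+_ d≡1 (≡.cong (2 ℕ.*_) (indicator-no (u Fin.≟ v) λ { ≡.refl → ~-irrefl u~v })))
    ... | distant _ _ _ d≡2 = ≡.cong₂ ℕ._+_ (indicator-no (v ~? u) λ v~u → 1≢2 (≡.trans (≡.sym (~⇒d≡1 (~-sym v~u))) d≡2))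
            (≡.cong₂ ℕ._+_ d≡2 (≡.cong (2 ℕ.*_) (indicator-no (u Fin.≟ v) λ { ≡.refl → 0≢2 (≡.trans (≡.sym (d-refl u)) d≡2) })))
      where
      1≢2 : 1 ≢ 2
      1≢2 ()
      0≢2 : 0 ≢ 2
      0≢2 ()

  -- As the diameter is at most 2, the neighbours of v dominate the graph.
  dominator : ∀ {v w₀} → v ~ w₀ → ∀ u → ∃[ w ] (v ~ w × (v ~ u → w ≡ u) × (u ≡ w ⊎ d u w ≡ 1))
  dominator {v} {w₀} v~w₀ u with position v u
  -- The vertex v is not a centre itself, so it joins the star of the given neighbour `w₀`.
  ... | equal ≡.refl _      = w₀ , v~w₀ , (λ v~v → contradiction v~v ~-irrefl) , inj₂ (~⇒d≡1 v~w₀)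
  ... | adjacent v~u _      = u , v~u , (λ _ → ≡.refl) , inj₁ ≡.refl
  ... | distant w v~w w~u d≡2 = w , v~w ,
          (λ v~u → contradiction (≡.trans (≡.sym (~⇒d≡1 v~u)) d≡2) λ ()) , inj₂ (~⇒d≡1 (~-sym w~u))

  open DistanceForm ℝ-orderedDomain d d-sym d-refl public

  L : Matrix ℝ n
  L = distanceLaplacian G connected

  I : Pred ℝ _
  I = ⟨ fromℤ (+ (2 ℕ.* n) ℤ.- 1ℤ) , fromℤ (+ (2 ℕ.* n)) ⟩

  L≡M : L ≡ M
  L≡M = ≡.refl

  -- Twice `transmission-degree` reads 2 Tr(v) + 2 deg(v) + 4 = 4n. Splitting 4n as 3n + n turns one
  -- inequality into the other.
  large-degree⇒small-transmission : (∀ v → n ℕ.≤ 2 ℕ.* degree v ℕ.+ 1) →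
    ∀ v → 2 ℕ.* transmissions v ℕ.+ 3 ℕ.≤ 3 ℕ.* n
  large-degree⇒small-transmission large v =
    ℕ.+-cancelʳ-≤ (2 ℕ.* degree v ℕ.+ 1) _ _ (begin
      2 ℕ.* transmissions v ℕ.+ 3 ℕ.+ (2 ℕ.* degree v ℕ.+ 1)
        ≡⟨ solve 2 (λ t k → con 2 :* t :+ con 3 :+ (con 2 :* k :+ con 1) :=
             con 2 :* (k :+ (t :+ con 2)))
             ≡.refl (transmissions v) (degree v) ⟩
      2 ℕ.* (degree v ℕ.+ (transmissions v ℕ.+ 2))
        ≡⟨ ≡.cong (2 ℕ.*_) (transmission-degree v) ⟩
      2 ℕ.* (n ℕ.* 2)
        ≡⟨ solve 1 (λ n → con 2 :* (n :* con 2) := con 3 :* n :+ n) ≡.refl n ⟩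
      3 ℕ.* n ℕ.+ n
        ≤⟨ ℕ.+-monoʳ-≤ (3 ℕ.* n) (large v) ⟩
      3 ℕ.* n ℕ.+ (2 ℕ.* degree v ℕ.+ 1) ∎)
    where
    open ℕ.≤-Reasoning
    open ℕ-Solver.+-*-Solver

  module _ (1≤n : 1 ℕ.≤ n) where

    large-degrees⇒no-eigenvalue : (∀ v → n ℕ.≤ 2 ℕ.* degree v ℕ.+ 1) → ∀ θ → IsEigenvalue L θ →
      ¬ I θ
    large-degrees⇒no-eigenvalue large θ (y , y≉0 , eigen) (β<θ , _) =
      small-transmissions⇒no-eigenvalue 1≤n L≡M d≥1 (large-degree⇒small-transmission large)
        θ (<ℝ⇒nonneg β θ β<θ) (<ℝ⇒≉ β θ β<θ) y eigen y≉0

    module _ {m} (count : EigenvalueCount L I m) where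
      open EigenvalueCount count renaming (total to m≡total)

      large-degrees⇒none : (∀ v → n ℕ.≤ 2 ℕ.* degree v ℕ.+ 1) → ¬ 0 ℕ.< m
      large-degrees⇒none large 0<m = small-transmissions⇒no-eigenvectors 1≤n L≡M eigenvalues distinct
        (λ i → <ℝ⇒nonneg β (eigenvalues i) (proj₁ (inInterval i)))
        (λ i → <ℝ⇒≉ β (eigenvalues i) (proj₁ (inInterval i)))
        multiplicity
        (λ i → proj₁ (dimension i)) (λ i → IsBasis.members (proj₂ (dimension i)))
        (λ i → IsBasis.independent (proj₂ (dimension i)))
        d≥1 (large-degree⇒small-transmission large) (≡.subst (0 ℕ.<_) m≡total 0<m)

      stars⇒few : ∀ {j} (c : Fin (suc j) → Fin n) (g : Fin n → Fin (suc j)) →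
        (∀ i → c (g (c i)) ≡ c i) → (∀ u → u ≡ c (g u) ⊎ d u (c (g u)) ≡ 1) → ¬ suc j ℕ.≤ m
      stars⇒few c g cgc near j<m = stars⇒few-eigenvectors 1≤n L≡M eigenvalues distinct
        (λ i → <ℝ⇒nonneg β (eigenvalues i) (proj₁ (inInterval i)))
        (λ i → <ℝ⇒≉ β (eigenvalues i) (proj₁ (inInterval i)))
        multiplicity
        (λ i → proj₁ (dimension i)) (λ i → IsBasis.members (proj₂ (dimension i)))
        (λ i → IsBasis.independent (proj₂ (dimension i)))
        c g cgc near d≤2 (≡.subst (_ ℕ.≤_) m≡total j<m)

      -- The neighbours of v are the centres, and each u goes to the star of its `dominator`; a
      -- neighbour dominates itself, so centres are fixed. The inner `go` abstracts from the list of
      -- neighbours so that its length can be matched as a successor; length zero is excluded by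
      -- `w₀`.
      degree>m : ∀ {v w₀} → v ~ w₀ → ¬ degree v ℕ.≤ m
      degree>m {v} v~w₀ = go (degree v) (neighbour v) (neighbour-~ v) ~⇒neighbour
        where
        go : ∀ k (c : Fin k → Fin n) → (∀ i → v ~ c i) → (∀ {u} → v ~ u → ∃[ i ] c i ≡ u) →
          ¬ k ℕ.≤ m
        go zero    c v~c ~⇒c _ with ~⇒c v~w₀
        ... | () , _
        go (suc j) c v~c ~⇒c = stars⇒few c g
          (λ i → ≡.trans (c-g (c i)) (proj₁ (proj₂ (proj₂ (dominator v~w₀ (c i)))) (v~c i)))
          (λ u → ≡.subst (λ w → u ≡ w ⊎ d u w ≡ 1) (≡.sym (c-g u)) (proj₂ (proj₂ (proj₂ (dominator v~w₀ u)))))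
          where
          g : Fin n → Fin (suc j)
          g u = proj₁ (~⇒c (proj₁ (proj₂ (dominator v~w₀ u))))

          c-g : ∀ u → c (g u) ≡ proj₁ (dominator v~w₀ u)
          c-g u = proj₂ (~⇒c (proj₁ (proj₂ (dominator v~w₀ u))))

-- Order two: arithmetic, K₂ and coronas

n≡2m+2 : ∀ m n → + m ℚ./ 1 ≡ + n ℚ./ 2 ℚ.- 1ℚ → n ≡ suc m ℕ.* 2
n≡2m+2 m n m≡n/2-1 = ≡.sym (ℤ.+-injective (≡.trans (ℤ.pos-* (suc m) 2)
  (≡.trans (cross (ℚ./-injective-≃ (ℚᵘ.mkℚᵘ (+ suc m) 0) (ℚᵘ.mkℚᵘ (+ n) 1) m+1≡n/2)) (ℤ.*-identityʳ (+ n)))))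
  where
  cross : ∀ {p q} → p ℚᵘ.≃ q → ℚᵘ.↥ p ℤ.* ℚᵘ.↧ q ≡ ℚᵘ.↥ q ℤ.* ℚᵘ.↧ p
  cross (ℚᵘ.*≡* eq) = eq

  -- Moving the 1 across leaves a single fraction on each side, ready for cross-multiplication.
  m+1≡n/2 : + suc m ℚ./ 1 ≡ + n ℚ./ 2
  m+1≡n/2 = begin
    + suc m ℚ./ 1                ≡⟨ /1-homo-+ (+ 1) (+ m) ⟩
    1ℚ ℚ.+ + m ℚ./ 1             ≡⟨ ≡.cong (1ℚ ℚ.+_) m≡n/2-1 ⟩
    1ℚ ℚ.+ (+ n ℚ./ 2 ℚ.- 1ℚ)    ≡⟨ solve 1 (λ q → con 1ℚ :+ (q :- con 1ℚ) := q)
         ≡.refl (+ n ℚ./ 2) ⟩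
    + n ℚ./ 2                    ∎
    where
    open ≡.≡-Reasoning
    open ℚ-Solver.+-*-Solver

edge : (G : Graph (Fin 2)) → Connected G → Graph._~_ G zero (suc zero)
edge G connected with Connected.path connected zero (suc zero)
... | _ , step _ {zero} 0~0 _ , _     = contradiction 0~0 (Graph.~-irrefl G)
... | _ , step _ {suc zero} 0~1 _ , _ = 0~1

singleton : Graph (Fin 1)
singleton = record
  { _~_ = λ _ _ → ⊥ ; _~?_ = λ _ _ → no λ () ; ~-sym = λ () ; ~-irrefl = λ () }

singleton-connected : Connected singleton
singleton-connected = record
  { nonempty = zero
  ; path     = λ { zero zero → 0 , stop zero , [] ∷ [] , ≡.refl }
  }

K₂≅singleton∘K₁ : (G : Graph (Fin 2)) → Connected G → G ≅ (singleton ∘K₁)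
K₂≅singleton∘K₁ G connected = record
  { bijection = Fin.+↔⊎ {1} {1}
  ; adjacency = λ where
      zero       zero       → mk⇔ (λ 0~0 → ~-irrefl 0~0) λ ()
      zero       (suc zero) → mk⇔ (λ _ → ≡.refl) (λ _ → edge G connected)
      (suc zero) zero       → mk⇔ (λ _ → ≡.refl) (λ _ → ~-sym (edge G connected))
      (suc zero) (suc zero) → mk⇔ (λ 1~1 → ~-irrefl 1~1) λ ()
  }
  where open Graph G

independenceNumber-K₂ : (G : Graph (Fin 2)) → Connected G → independenceNumber G ≡ 1
independenceNumber-K₂ G connected with independenceNumber-spec G
... | α , (S , independent , ∣S∣≡α) , maximal = ℕ.≤-antisym
  (≡.subst (ℕ._≤ 1) ∣S∣≡α (≤1 S independent))
  (maximal 1 (⁅ zero ⁆ , single , ≡.refl))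
  where
  single : Independent G ⁅ zero ⁆
  single u v u∈ v∈ u~v with Subset.x∈⁅y⁆⇒x≡y zero u∈ | Subset.x∈⁅y⁆⇒x≡y zero v∈
  ... | ≡.refl | ≡.refl = Graph.~-irrefl G u~v

  ≤1 : ∀ S → Independent G S → ∣ S ∣ ℕ.≤ 1
  ≤1 (inside  ∷ inside  ∷ []) independent =
    contradiction (edge G connected) (independent zero (suc zero) here (there here))
  ≤1 (inside  ∷ outside ∷ []) _ = ℕ.≤-refl
  ≤1 (outside ∷ inside  ∷ []) _ = ℕ.≤-refl
  ≤1 (outside ∷ outside ∷ []) _ = ℕ.z≤n

-- Two pendant vertices of a corona are at distance at least 3.
corona-order : ∀ {n k} {G : Graph (Fin n)} {H : Graph (Fin k)} (connected : Connected G) →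
  diameter G connected ℕ.≤ 2 → Connected H → G ≅ (H ∘K₁) → n ≡ 2
corona-order {n} {k} {G} {H} connected diam≤2 H-connected iso =
  ≡.trans (Permutation.↔⇒≡ (↔-sym Fin.+↔⊎ ↔-∘ bijection)) (≡.cong (λ k → k ℕ.+ k) k≡1)
  where
  open _≅_ iso
  open Inverse bijection using (to; from; strictlyInverseˡ)
  open DiameterTwo G connected diam≤2 using (Position; equal; adjacent; distant; position)

  pendants-equal : ∀ a b → a ≡ b
  pendants-equal a b = go (position (from (inj₂ a)) (from (inj₂ b)))
    where
    map~ : ∀ {u v x y} → to u ≡ x → to v ≡ y → Graph._~_ G u v → Graph._~_ (H ∘K₁) x y
    map~ {u} {v} ≡.refl ≡.refl = Equivalence.to (adjacency u v)

    middle : ∀ x → Graph._~_ (H ∘K₁) (inj₂ a) x → Graph._~_ (H ∘K₁) x (inj₂ b) → a ≡ b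
    middle (inj₁ _) a≡x x≡b = ≡.trans a≡x x≡b

    go : Position (from (inj₂ a)) (from (inj₂ b)) → a ≡ b
    go (equal eq _) = inj₂-injective
      (≡.trans (≡.sym (strictlyInverseˡ (inj₂ a))) (≡.trans (≡.cong to eq) (strictlyInverseˡ (inj₂ b))))
    go (adjacent u~v _) = contradiction (map~ (strictlyInverseˡ (inj₂ a)) (strictlyInverseˡ (inj₂ b)) u~v) λ ()
    go (distant w u~w w~v _) = middle (to w)
      (map~ (strictlyInverseˡ (inj₂ a)) ≡.refl u~w) (map~ ≡.refl (strictlyInverseˡ (inj₂ b)) w~v)

  order-1 : ∀ {k} → Fin k → (∀ (a b : Fin k) → a ≡ b) → k ≡ 1
  order-1 {suc zero}    _ _     = ≡.refl
  order-1 {suc (suc _)} _ all-equal with all-equal zero (suc zero)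
  ... | ()

  k≡1 : k ≡ 1
  k≡1 = order-1 (Connected.nonempty H-connected) pendants-equal

-- From the eigenvalue count to order two and back

module _ {n} (G : Graph (Fin n)) (connected : Connected G) (diam≤2 : diameter G connected ℕ.≤ 2) where
  open DiameterTwo G connected diam≤2

  count⇒order-2 : ∀ m → n ≡ suc m ℕ.* 2 → EigenvalueCount L I m → n ≡ 2
  count⇒order-2 zero    n≡2    _     = n≡2
  count⇒order-2 (suc m) ≡.refl count with Fin.all? (λ v → n ℕ.≤? 2 ℕ.* degree v ℕ.+ 1)
  ... | yes large = contradiction (ℕ.s≤s ℕ.z≤n) (large-degrees⇒none (ℕ.s≤s ℕ.z≤n) count large)
  ... | no ¬large with Fin.¬∀⟶∃¬ n _ (λ v → n ℕ.≤? 2 ℕ.* degree v ℕ.+ 1) ¬large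
  ...   | v , small = contradiction degree≤m (degree>m (ℕ.s≤s ℕ.z≤n) count (proj₂ (neighbour-of v (proj₂ other))))
    where
    other : ∃[ u ] v ≢ u
    other with v Fin.≟ zero
    ... | yes ≡.refl = suc zero , λ ()
    ... | no v≢0     = zero , v≢0

    -- Here the count is `suc m` and n = 2 (m + 2). From 2 deg(v) + 1 < n follows 2 deg(v) + 2 ≤ 2
    -- (m + 1) + 2, so the degree is at most the count.
    degree≤m : degree v ℕ.≤ suc m
    degree≤m = ℕ.*-cancelˡ-≤ 2 (ℕ.≤-pred (ℕ.≤-pred (begin
      suc (suc (2 ℕ.* degree v))     ≡⟨ ≡.cong suc (ℕ.+-comm 1 (2 ℕ.* degree v)) ⟩
      suc (2 ℕ.* degree v ℕ.+ 1)     ≤⟨ ℕ.≰⇒> small ⟩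
      suc (suc m) ℕ.* 2              ≡⟨ ℕ.*-comm (suc (suc m)) 2 ⟩
      2 ℕ.* suc (suc m)              ≡⟨ ℕ.*-suc 2 (suc m) ⟩
      2 ℕ.+ 2 ℕ.* suc m              ∎)))
      where open ℕ.≤-Reasoning

  -- Both vertices of K₂ have a neighbour, so n ≤ 2 deg(v) + 1 holds and the large-degree bound
  -- leaves no eigenvalue in the interval; the empty list is therefore complete.
  count-zero : n ≡ 2 → EigenvalueCount L I 0
  count-zero ≡.refl = record
    { r            = 0
    ; eigenvalues  = λ ()
    ; distinct     = λ ()
    ; isEigenvalue = λ ()
    ; inInterval   = λ ()
    ; complete     = λ θ eigenvalue θ∈I →
        contradiction θ∈I (large-degrees⇒no-eigenvalue (ℕ.s≤s ℕ.z≤n) large θ eigenvalue)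
    ; multiplicity = λ ()
    ; dimension    = λ ()
    ; total        = ≡.refl
    }
    where
    neighboured : ∀ v → ∃[ w ] Graph._~_ G v w
    neighboured zero       = suc zero , edge G connected
    neighboured (suc zero) = zero , Graph.~-sym G (edge G connected)

    large : ∀ v → 2 ℕ.≤ 2 ℕ.* degree v ℕ.+ 1
    large v = ℕ.≤-trans (ℕ.*-monoʳ-≤ 2 (Fin⇒1≤ (proj₁ (~⇒neighbour (proj₂ (neighboured v)))))) (ℕ.m≤m+n _ 1)
      where
      Fin⇒1≤ : ∀ {k} → Fin k → 1 ℕ.≤ k
      Fin⇒1≤ {suc _} _ = ℕ.s≤s ℕ.z≤n

theorem3p9 : ∀ (n : ℕ) (G : Graph (Fin n)) (connected : Connected G) →
    diameter G connected ℕ.≤ 2 →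
    (∃[ m ] (EigenvalueCount (distanceLaplacian G connected)
    ⟨ fromℤ (+ (2 ℕ.* n) ℤ.- 1ℤ) , fromℤ (+ (2 ℕ.* n)) ⟩ m
    × (+ m / 1 ≡ + independenceNumber G / 1 ℚ.- 1ℚ)
    × (+ independenceNumber G / 1 ℚ.- 1ℚ ≡ + n / 2 ℚ.- 1ℚ)))
    ⇔
    (∃[ k ] Σ[ H ∈ Graph (Fin k) ] (Connected H × G ≅ (H ∘K₁)))
theorem3p9 n G connected diam≤2 = mk⇔
  (λ (m , count , m≡α-1 , α-1≡n/2-1) → corona G connected
    (count⇒order-2 G connected diam≤2 m (n≡2m+2 m n (≡.trans m≡α-1 α-1≡n/2-1)) count))
  (λ (k , H , H-connected , iso) →
    let n≡2 = corona-order connected diam≤2 H-connected iso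
        α-1≡0 , n/2-1≡0 = sizes G connected n≡2
    in 0 , count-zero G connected diam≤2 n≡2 , ≡.sym α-1≡0 , ≡.trans α-1≡0 (≡.sym n/2-1≡0))
  where
  corona : ∀ {n} (G : Graph (Fin n)) → Connected G → n ≡ 2 →
    ∃[ k ] Σ[ H ∈ Graph (Fin k) ] (Connected H × G ≅ (H ∘K₁))
  corona G connected ≡.refl = 1 , singleton , singleton-connected , K₂≅singleton∘K₁ G connected

  sizes : ∀ {n} (G : Graph (Fin n)) → Connected G → n ≡ 2 →
    (+ independenceNumber G / 1 ℚ.- 1ℚ ≡ + 0 / 1) × (+ n / 2 ℚ.- 1ℚ ≡ + 0 / 1)
  sizes G connected ≡.refl =
    ≡.cong (λ α → + α / 1 ℚ.- 1ℚ) (independenceNumber-K₂ G connected) , ≡.refl
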